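{- Let $n,k,\ell,\ell',t$ be integers with $n\ge 2$ and $k\ge \ell\ge \ell'\ge t\ge 1$. Let $[m]=X_1\cup\dots\cup X_k$ with the $X_i$ pairwise disjoint, $|X_i|=n$, and let $v_i$ be the smallest element of $X_i$. Define $\mathcal{F}_0=\{F\in\mathcal{H}(n,k,\ell): |F\cap\{v_1,\dots,v_{\ell'}\}|\ge t\}$ and $\mathcal{G}_0=\{\{v_1,\dots,v_{\ell'}\}\}$, and for every integer $a\ge 1$ define $\mathcal{F}_a=\{F\in\mathcal{H}(n,k,\ell): \{v_1,\dots,v_a\}\subseteq F\}$ and $\mathcal{G}_a=\{G\in\mathcal{H}(n,k,\ell'): |G\cap\{v_1,\dots,v_a\}|\ge t\}$. If $\mathcal{F}\subseteq\mathcal{H}(n,k,\ell)$ and $\mathcal{G}\subseteq\mathcal{H}(n,k,\ell')$ are both non-empty and cross $t$-intersecting, then $$|\mathcal{F}|+|\mathcal{G}|\le \max\Big\{|\mathcal{F}_0|+|\mathcal{G}_0|,\ \max_{a\in[\ell'+1,\ell]}\{|\mathcal{F}_a|+|\mathcal{G}_a|\}\Big\},$$ where the inner maximum is omitted if $\ell=\ell'$.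
   Context: For integers $p\le q$, $[p,q]=\{p,p+1,\dots,q\}$ and $[q]=[1,q]$. Here $m=kn$ and the elements of $[m]$ carry their natural order. For $\ell\in[k]$, $\mathcal{H}(n,k,\ell)=\{H\subseteq[m]: |H|=\ell,\ |H\cap X_i|\le 1 \text{ for all } i\in[k]\}$. Two families $\mathcal{F},\mathcal{G}$ are cross $t$-intersecting if $|F\cap G|\ge t$ for all $F\in\mathcal{F}$, $G\in\mathcal{G}$. -}

module Defs where

open import Data.Bool.Properties using () renaming (_≟_ to _≟ᵇ_)
open import Data.Fin using (Fin; toℕ) renaming (_≤_ to _≤ᶠ_)
open import Data.Fin.Properties using (all?)
open import Data.Fin.Subset
  using (Subset; Side; inside; outside; _∈_; _⊆_; _∩_; ⋃; ⁅_⁆; ∣_∣; Empty; ⊤)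
open import Data.Fin.Subset.Properties using (_⊆?_)
open import Data.List
  using (List; []; _∷_; length; filter; map; allFin; tabulate; applyUpTo; cartesianProductWith)
open import Data.List.Membership.Propositional using () renaming (_∈_ to _∈ˡ_)
open import Data.List.Membership.Propositional.Properties using (∈-cartesianProductWith⁺)
open import Data.List.Relation.Unary.All using ([]; _∷_)
open import Data.List.Relation.Unary.AllPairs using ([]; _∷_)
open import Data.List.Relation.Unary.Any using (here; there)
open import Data.List.Relation.Unary.Unique.Propositional using (Unique)
open import Data.List.Relation.Unary.Unique.Propositional.Properties using (cartesianProductWith⁺)
open import Data.Nat using (ℕ; _+_; _*_; _∸_; _≤_; _≤?_; _<?_; _≟_)
open import Data.Product using (_×_)
open import Data.Vec using ([]; _∷_)
open import Data.Vec.Properties using (≡-dec; ∷-injective)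
open import Level using (0ℓ)
open import Relation.Binary.PropositionalEquality using (_≡_; _≢_; refl)
open import Relation.Nullary.Decidable using (_×-dec_)
open import Relation.Unary using (Pred; Decidable)

-- The ordered ground set {1,…,m} is modelled by Fin m (x stands for toℕ x + 1),
-- and indices 1,…,k by Fin k in the same way.

sides : List Side
sides = outside ∷ inside ∷ []

allSubsets : ∀ m → List (Subset m)
allSubsets 0           = [] ∷ []
allSubsets (ℕ.suc m) = cartesianProductWith _∷_ sides (allSubsets m)

∈-allSubsets : ∀ {m} (S : Subset m) → S ∈ˡ allSubsets m
∈-allSubsets []            = here refl
∈-allSubsets (outside ∷ S) = ∈-cartesianProductWith⁺ _∷_ {xs = sides} (here refl) (∈-allSubsets S)
∈-allSubsets (inside ∷ S)  = ∈-cartesianProductWith⁺ _∷_ {xs = sides} (there (here refl)) (∈-allSubsets S)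

allSubsets-unique : ∀ m → Unique (allSubsets m)
allSubsets-unique 0         = [] ∷ []
allSubsets-unique (ℕ.suc m) =
  cartesianProductWith⁺ _∷_ ∷-injective (((λ ()) ∷ []) ∷ [] ∷ []) (allSubsets-unique m)

-- Decidability of membership is what makes the size of a family computable;
-- classically it is no restriction.
Family : ℕ → Set₁
Family m = Pred (Subset m) 0ℓ

card : ∀ {m} {𝓕 : Family m} → Decidable 𝓕 → ℕ
card {m} 𝓕? = length (filter 𝓕? (allSubsets m))

CrossIntersecting : ∀ {m} → ℕ → Family m → Family m → Set
CrossIntersecting t 𝓕 𝓖 = ∀ {F G} → 𝓕 F → 𝓖 G → t ≤ ∣ F ∩ G ∣

record IsPartition {k m} (n : ℕ) (X : Fin k → Subset m) : Set where
  field
    disjoint : ∀ {i j} → i ≢ j → Empty (X i ∩ X j)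
    covers   : ⋃ (tabulate X) ≡ ⊤
    size     : ∀ i → ∣ X i ∣ ≡ n

IsSmallest : ∀ {m} → Subset m → Fin m → Set
IsSmallest S x = x ∈ S × (∀ {y} → y ∈ S → x ≤ᶠ y)

module _ {k m : ℕ} (X : Fin k → Subset m) where

  𝓗 : ℕ → Family m
  𝓗 ℓ H = ∣ H ∣ ≡ ℓ × (∀ i → ∣ H ∩ X i ∣ ≤ 1)

  𝓗? : ∀ ℓ → Decidable (𝓗 ℓ)
  𝓗? ℓ H = (∣ H ∣ ≟ ℓ) ×-dec all? (λ i → ∣ H ∩ X i ∣ ≤? 1)

-- {v₁,…,v_a}; only used for a ≤ k.
firstVs : ∀ {k m} → (Fin k → Fin m) → ℕ → Subset m
firstVs {k} v a = ⋃ (map (λ i → ⁅ v i ⁆) (filter (λ i → toℕ i <? a) (allFin k)))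

module _ {k m : ℕ} (X : Fin k → Subset m) (v : Fin k → Fin m) where

  𝓕₀ : (ℓ ℓ′ t : ℕ) → Family m
  𝓕₀ ℓ ℓ′ t F = 𝓗 X ℓ F × t ≤ ∣ F ∩ firstVs v ℓ′ ∣

  𝓕₀? : ∀ ℓ ℓ′ t → Decidable (𝓕₀ ℓ ℓ′ t)
  𝓕₀? ℓ ℓ′ t F = 𝓗? X ℓ F ×-dec (t ≤? ∣ F ∩ firstVs v ℓ′ ∣)

  𝓖₀ : (ℓ′ : ℕ) → Family m
  𝓖₀ ℓ′ G = G ≡ firstVs v ℓ′

  𝓖₀? : ∀ ℓ′ → Decidable (𝓖₀ ℓ′)
  𝓖₀? ℓ′ G = ≡-dec _≟ᵇ_ G (firstVs v ℓ′)

  𝓕ₐ : (ℓ a : ℕ) → Family m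
  𝓕ₐ ℓ a F = 𝓗 X ℓ F × firstVs v a ⊆ F

  𝓕ₐ? : ∀ ℓ a → Decidable (𝓕ₐ ℓ a)
  𝓕ₐ? ℓ a F = 𝓗? X ℓ F ×-dec (firstVs v a ⊆? F)

  𝓖ₐ : (ℓ′ t a : ℕ) → Family m
  𝓖ₐ ℓ′ t a G = 𝓗 X ℓ′ G × t ≤ ∣ G ∩ firstVs v a ∣

  𝓖ₐ? : ∀ ℓ′ t a → Decidable (𝓖ₐ ℓ′ t a)
  𝓖ₐ? ℓ′ t a G = 𝓗? X ℓ′ G ×-dec (t ≤? ∣ G ∩ firstVs v a ∣)

-- p, p+1, …, q; empty when p > q.
interval : ℕ → ℕ → List ℕ
interval p q = applyUpTo (p +_) (ℕ.suc q ∸ p)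

{-# OPTIONS --safe #-}
-- Involutions f of the ground set that permute the blocks X_i act on cross t-intersecting pairs
-- (𝓐,𝓑), and a pair can be uncrossed with its image: (𝓐 ∩ f𝓐, 𝓑 ∪ f𝓑) and (𝓐 ∪ f𝓐, 𝓑 ∩ f𝓑)
-- are cross t-intersecting and their sizes add up to 2(|𝓐| + |𝓑|). Hence, in a counterexample
-- of maximal size whose smaller member 𝓐 is minimal, f𝓐 meets 𝓐 only if f𝓐 = 𝓐.
-- If two sets of such an 𝓐 differ in a single element, then stabilisers of members of 𝓐 provide
-- enough such pairs to lower |A ∩ G| below t for any G∈𝓑, one element at a time.
-- Otherwise 𝓐 is a singleton, or n = 2 and all sets in 𝓐 meet the same X_i; in the latter case
-- |𝓐| - 1 sets meet a given A in at least t elements without belonging to 𝓑, so that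
-- replacing 𝓐 by {A} loses nothing. By symmetry A may be taken to be {v₁,…,v_p}: the optimum is
-- attained at (𝓕₀,𝓖₀) or, among the values of a, at a = ℓ.
module Submission where

open import Defs
open import Algebra.Properties.CommutativeSemigroup using (interchange)
open import Data.Bool using (if_then_else_)
open import Data.Bool.Properties using () renaming (_≟_ to _≟ᵇ_)
open import Data.Empty using (⊥; ⊥-elim)
open import Data.Fin using (Fin; zero; suc; toℕ; fromℕ<)
open import Data.Fin.Properties using (any?; 0≢1+n; toℕ-fromℕ<; toℕ-injective)
  renaming (_≟_ to _≟ᶠ_; suc-injective to sucᶠ-injective)
open import Data.Fin.Subset
  using (Subset; inside; outside; _∈_; _∉_; _⊂_; _∩_; _-_; Empty; ⋃; ⁅_⁆; ∣_∣) renaming (_⊆_ to _⊆ˢ_)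
open import Data.Fin.Subset.Properties
open import Data.List using (List; []; _∷_; _++_; length; filter; map; allFin)
open import Data.List.Extrema.Nat using (max; ⊥≤max; xs≤max)
open import Data.List.Membership.Propositional using (find; lose) renaming (_∈_ to _∈ˡ_)
open import Data.List.Membership.Propositional.Properties
  using (∈-∃++; ∈-filter⁺; ∈-filter⁻; ∈-++⁻; ∈-++⁺ˡ; ∈-++⁺ʳ; ∈-map⁺; ∈-allFin; ∈-applyUpTo⁺)
open import Data.List.Properties using (length-filter; length-++-sucʳ)
import Data.List.Relation.Unary.All as All
open import Data.List.Relation.Unary.AllPairs using ([]; _∷_)
open import Data.List.Relation.Unary.Any using (Any; here; there)
import Data.List.Relation.Unary.Any.Properties as Any
open import Data.List.Relation.Unary.Unique.Propositional using (Unique)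
open import Data.List.Relation.Unary.Unique.Propositional.Properties using (filter⁺)
open import Data.Nat
  using (ℕ; zero; suc; _+_; _*_; _∸_; _≤_; _<_; _⊓_; _<?_; _≤?_; z≤n; s≤s; s≤s⁻¹)
open import Data.Nat.Properties hiding (0≢1+n)
open import Data.Product using (∃; Σ; _×_; _,_; proj₁; proj₂)
open import Data.Sum as Sum using (_⊎_; inj₁; inj₂; [_,_]′)
open import Data.Vec using ([]; _∷_; here; there; lookup; tabulate)
open import Data.Vec.Properties using (≡-dec; []=⇒lookup; lookup⇒[]=; lookup∘tabulate)
open import Function using (_∘_; id; case_of_)
open import Level using (0ℓ)
open import Relation.Binary.Definitions using (DecidableEquality)
open import Relation.Binary.PropositionalEquality
open import Relation.Nullary using (¬_; Dec; yes; no; does; contradiction)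
open import Relation.Nullary.Decidable using (_×-dec_; _⊎-dec_; ¬?; decidable-stable)
open import Relation.Unary using (Pred; Decidable; Satisfiable; _⊆_)
open import Relation.Unary.Properties using (_∪?_; _∩?_; ∁?)

-- Counting families and subsets.

-- Deleting one occurrence of `h x` from `ys` costs no other image, because `h` is injective on
-- `xs`; the induction goes on with the shortened list.
length-injection : ∀ {A B : Set} (h : A → B) {xs : List A} {ys : List B} → Unique xs →
  (∀ {x} → x ∈ˡ xs → h x ∈ˡ ys) →
  (∀ {x y} → x ∈ˡ xs → y ∈ˡ xs → h x ≡ h y → x ≡ y) →
  length xs ≤ length ys
length-injection h {[]} _ _ _ = z≤n
length-injection h {x ∷ xs} (x∉xs ∷ uniq) into inj with ∈-∃++ (into (here refl))
... | as , bs , refl =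
  subst (suc (length xs) ≤_) (sym (length-++-sucʳ as (h x) bs))
    (s≤s (length-injection h uniq into′ λ p q → inj (there p) (there q)))
  where
  into′ : ∀ {y} → y ∈ˡ xs → h y ∈ˡ as ++ bs
  into′ y∈xs with ∈-++⁻ as (into (there y∈xs))
  ... | inj₁ p           = ∈-++⁺ˡ p
  ... | inj₂ (there p)   = ∈-++⁺ʳ as p
  ... | inj₂ (here hy≡hx) =
    contradiction (inj (here refl) (there y∈xs) (sym hy≡hx)) (All.lookup x∉xs y∈xs)

length-filter-∪-∩ : ∀ {A : Set} {P Q : Pred A 0ℓ} (P? : Decidable P) (Q? : Decidable Q) (xs : List A) →
  length (filter P? xs) + length (filter Q? xs) ≡
  length (filter (P? ∪? Q?) xs) + length (filter (P? ∩? Q?) xs)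
length-filter-∪-∩ P? Q? [] = refl
length-filter-∪-∩ P? Q? (x ∷ xs) with P? x | Q? x | length-filter-∪-∩ P? Q? xs
... | yes _ | yes _ | eq = cong suc (trans (+-suc _ _) (trans (cong suc eq) (sym (+-suc _ _))))
... | yes _ | no _  | eq = cong suc eq
... | no _  | yes _ | eq = trans (+-suc _ _) (cong suc eq)
... | no _  | no _  | eq = eq

module _ {m : ℕ} {𝓟 𝓠 : Family m} (𝓟? : Decidable 𝓟) (𝓠? : Decidable 𝓠) where

  card-injection : (h : Subset m → Subset m) → (∀ {F} → 𝓟 F → 𝓠 (h F)) →
    (∀ {F G} → 𝓟 F → 𝓟 G → h F ≡ h G → F ≡ G) → card 𝓟? ≤ card 𝓠?
  card-injection h into inj = length-injection h (filter⁺ 𝓟? (allSubsets-unique m))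
    (λ F∈ → ∈-filter⁺ 𝓠? (∈-allSubsets _) (into (holds F∈)))
    (λ F∈ G∈ → inj (holds F∈) (holds G∈))
    where
    holds : ∀ {F} → F ∈ˡ filter 𝓟? (allSubsets m) → 𝓟 F
    holds F∈ = proj₂ (∈-filter⁻ 𝓟? {xs = allSubsets m} F∈)

  card-mono : 𝓟 ⊆ 𝓠 → card 𝓟? ≤ card 𝓠?
  card-mono P⊆Q = card-injection id P⊆Q λ _ _ → id

  card-mono-< : ∀ {F} → 𝓟 ⊆ 𝓠 → 𝓠 F → ¬ 𝓟 F → card 𝓟? < card 𝓠?
  card-mono-< {F} P⊆Q QF ¬PF = length-injection id
    (All.tabulate (λ G∈ F≡G → ¬PF (subst 𝓟 (sym F≡G) (holds G∈))) ∷ filter⁺ 𝓟? (allSubsets-unique m))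
    into (λ _ _ → id)
    where
    holds : ∀ {G} → G ∈ˡ filter 𝓟? (allSubsets m) → 𝓟 G
    holds G∈ = proj₂ (∈-filter⁻ 𝓟? {xs = allSubsets m} G∈)
    into : ∀ {G} → G ∈ˡ (F ∷ filter 𝓟? (allSubsets m)) → G ∈ˡ filter 𝓠? (allSubsets m)
    into (here refl) = ∈-filter⁺ 𝓠? (∈-allSubsets _) QF
    into (there G∈)  = ∈-filter⁺ 𝓠? (∈-allSubsets _) (P⊆Q (holds G∈))

  card-∪-∩ : card 𝓟? + card 𝓠? ≡ card (𝓟? ∪? 𝓠?) + card (𝓟? ∩? 𝓠?)
  card-∪-∩ = length-filter-∪-∩ 𝓟? 𝓠? (allSubsets m)

card>0 : ∀ {m F} {𝓟 : Family m} (𝓟? : Decidable 𝓟) → 𝓟 F → 0 < card 𝓟?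
card>0 {m} {F} 𝓟? PF = ≤-trans (s≤s z≤n) (card-mono-< {m} (λ _ → no id) 𝓟? ⊥-elim PF id)

size-injection : ∀ {m m′} {S : Subset m} {T : Subset m′} (h : Fin m → Fin m′) →
  (∀ {x} → x ∈ S → h x ∈ T) → (∀ {x y} → x ∈ S → y ∈ S → h x ≡ h y → x ≡ y) → ∣ S ∣ ≤ ∣ T ∣
size-injection {S = []} h into inj = z≤n
size-injection {S = outside ∷ S} h into inj =
  size-injection {S = S} (h ∘ suc) (into ∘ there) λ p q eq → sucᶠ-injective (inj (there p) (there q) eq)
size-injection {S = inside ∷ S} {T} h into inj = ≤-trans
  (s≤s (size-injection {S = S} {T - h zero} (h ∘ suc)
    (λ p → x∈p∧x≢y⇒x∈p-y (into (there p)) λ eq → 0≢1+n (inj here (there p) (sym eq)))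
    λ p q eq → sucᶠ-injective (inj (there p) (there q) eq)))
  (x∈p⇒∣p-x∣<∣p∣ (into here))

size-remove : ∀ {m x} {S : Subset m} → x ∈ S → ∣ S ∣ ≡ suc ∣ S - x ∣
size-remove {S = _ ∷ S} here = cong (suc ∘ ∣_∣) (sym (p─⊥≡p S))
size-remove {S = outside ∷ S} (there x∈S) = size-remove x∈S
size-remove {S = inside ∷ S} (there x∈S) = cong suc (size-remove x∈S)

x∉p-x : ∀ {m x} {S : Subset m} → x ∉ S - x
x∉p-x {x = zero} {_ ∷ S} ()
x∉p-x {x = suc x} {_ ∷ S} (there p) = x∉p-x {x = x} {S} p

x∈⋃⁺ : ∀ {m x} {Ss : List (Subset m)} → Any (x ∈_) Ss → x ∈ ⋃ Ss
x∈⋃⁺ (here p)  = x∈p∪q⁺ (inj₁ p)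
x∈⋃⁺ (there p) = x∈p∪q⁺ (inj₂ (x∈⋃⁺ p))

x∈⋃⁻ : ∀ {m x} (Ss : List (Subset m)) → x ∈ ⋃ Ss → Any (x ∈_) Ss
x∈⋃⁻ []       p = contradiction p ∉⊥
x∈⋃⁻ (S ∷ Ss) p with x∈p∪q⁻ S (⋃ Ss) p
... | inj₁ q = here q
... | inj₂ q = there (x∈⋃⁻ Ss q)

size≤1 : ∀ {m} {S : Subset m} → (∀ {x y} → x ∈ S → y ∈ S → x ≡ y) → ∣ S ∣ ≤ 1
size≤1 {m} {S} same = size-injection {T = inside ∷ []} (λ _ → zero) (λ _ → here) λ p q _ → same p q

size≤1⁻ : ∀ {m} {S : Subset m} → ∣ S ∣ ≤ 1 → ∀ {x y} → x ∈ S → y ∈ S → x ≡ y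
size≤1⁻ {S = S} ∣S∣≤1 {x} {y} x∈S y∈S with x ≟ᶠ y
... | yes x≡y = x≡y
... | no  x≢y = contradiction ∣S∣≤1 (<⇒≱ (subst (_< ∣ S ∣) (∣⁅x⁆∣≡1 x)
  (p⊂q⇒∣p∣<∣q∣ ((λ z∈ → subst (_∈ S) (sym (x∈⁅y⁆⇒x≡y x z∈)) x∈S) ,
    y , y∈S , λ y∈ → x≢y (sym (x∈⁅y⁆⇒x≡y x y∈))))))

nonempty-size : ∀ {m} {S : Subset m} → 0 < ∣ S ∣ → ∃ (_∈ S)
nonempty-size {m} {S} 0<∣S∣ with nonempty? S
... | yes ne = ne
... | no ¬ne = contradiction (subst (λ T → 0 < ∣ T ∣) (Empty-unique ¬ne) 0<∣S∣)
  (λ 0<0 → <-irrefl refl (subst (0 <_) (∣⊥∣≡0 m) 0<0))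

escapee : ∀ {m} (S T : Subset m) → ¬ (T ⊆ˢ S) → ∃ λ x → x ∈ T × x ∉ S
escapee S T T⊈S with any? (λ x → (x ∈? T) ×-dec ¬? (x ∈? S))
... | yes found = found
... | no  none  = ⊥-elim (T⊈S T⊆S)
  where
  T⊆S : T ⊆ˢ S
  T⊆S {x} x∈T = decidable-stable (x ∈? S) λ x∉S → none (x , x∈T , x∉S)

size-exceeds : ∀ {m} {S T : Subset m} → ∣ S ∣ < ∣ T ∣ → ∃ λ x → x ∈ T × x ∉ S
size-exceeds {S = S} {T} lt = escapee S T λ T⊆S → <⇒≱ lt (p⊆q⇒∣p∣≤∣q∣ T⊆S)

⊆∧size≡⇒≡ : ∀ {m} {S T : Subset m} → S ⊆ˢ T → ∣ S ∣ ≡ ∣ T ∣ → S ≡ T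
⊆∧size≡⇒≡ {S = S} {T} S⊆T eq = ⊆-antisym S⊆T λ {x} x∈T →
  decidable-stable (x ∈? S) λ x∉S → <-irrefl eq (p⊂q⇒∣p∣<∣q∣ (S⊆T , x , x∈T , x∉S))

_≟ˢ_ : ∀ {m} → DecidableEquality (Subset m)
_≟ˢ_ = ≡-dec _≟ᵇ_

card-empty : ∀ {m} {𝓟 : Family m} (𝓟? : Decidable 𝓟) → (∀ {F} → ¬ 𝓟 F) → card 𝓟? ≡ 0
card-empty {m} 𝓟? empty = n≤0⇒n≡0 (length-injection {B = Subset m} id {ys = []}
  (filter⁺ 𝓟? (allSubsets-unique m))
  (λ F∈ → ⊥-elim (empty (proj₂ (∈-filter⁻ 𝓟? {xs = allSubsets m} F∈)))) λ _ _ → id)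

card-remove : ∀ {m} {𝓟 : Family m} (𝓟? : Decidable 𝓟) (z : Subset m) →
  card 𝓟? ≤ suc (card (𝓟? ∩? ∁? (_≟ˢ z)))
card-remove {m} {𝓟} 𝓟? z = length-injection id (filter⁺ 𝓟? (allSubsets-unique m)) into (λ _ _ → id)
  where
  into : ∀ {F} → F ∈ˡ filter 𝓟? (allSubsets m) → F ∈ˡ z ∷ filter (𝓟? ∩? ∁? (_≟ˢ z)) (allSubsets m)
  into {F} F∈ with F ≟ˢ z
  ... | yes F≡z = here F≡z
  ... | no  F≢z = there (∈-filter⁺ (𝓟? ∩? ∁? (_≟ˢ z)) (∈-allSubsets F)
                    (proj₂ (∈-filter⁻ 𝓟? {xs = allSubsets m} F∈) , F≢z))

nonempty-∩ : ∀ {m t} {S T : Subset m} → 1 ≤ t → t ≤ ∣ S ∩ T ∣ → ∃ λ x → x ∈ S × x ∈ T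
nonempty-∩ {S = S} {T} 1≤t t≤ = let x , x∈ = nonempty-size (≤-trans 1≤t t≤) in x , x∈p∩q⁻ S T x∈

size>0 : ∀ {m x} {S : Subset m} → x ∈ S → 1 ≤ ∣ S ∣
size>0 x∈S = subst (1 ≤_) (sym (size-remove x∈S)) (s≤s z≤n)

card-satisfiable : ∀ {m} {𝓟 : Family m} (𝓟? : Decidable 𝓟) → 0 < card 𝓟? → Satisfiable 𝓟
card-satisfiable {m} {𝓟} 𝓟? 0<c = go (filter 𝓟? (allSubsets m)) refl 0<c
  where
  go : ∀ xs → filter 𝓟? (allSubsets m) ≡ xs → 0 < length xs → Satisfiable 𝓟
  go (F ∷ _) eq _ = F , proj₂ (∈-filter⁻ 𝓟? {xs = allSubsets m} (subst (F ∈ˡ_) (sym eq) (here refl)))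

-- The two uncrossed totals add up to 2(a + b), so if one is below the average, the other is above
-- it. If `b∩` were 0, then `b∪` would be 2b, which is at least a + b as a ≤ b, against the strict
-- inequality.
uncrossing : ∀ {a b a∩ a∪ b∩ b∪} → a + a ≡ a∪ + a∩ → b + b ≡ b∪ + b∩ → a ≤ b →
  a∩ + b∪ < a + b → 0 < b∩ × a + b < a∪ + b∩
uncrossing {a} {b} {a∩} {a∪} {b∩} {b∪} a+a b+b a≤b lt = positive b∩ refl , +-cancelˡ-< (a∩ + b∪) _ _ (begin-strict
    (a∩ + b∪) + (a + b)   <⟨ +-monoˡ-< (a + b) lt ⟩
    (a + b) + (a + b)     ≡⟨ +-interchange a b a b ⟩
    (a + a) + (b + b)     ≡⟨ cong₂ _+_ a+a b+b ⟩
    (a∪ + a∩) + (b∪ + b∩) ≡⟨ cong (_+ (b∪ + b∩)) (+-comm a∪ a∩) ⟩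
    (a∩ + a∪) + (b∪ + b∩) ≡⟨ +-interchange a∩ a∪ b∪ b∩ ⟩
    (a∩ + b∪) + (a∪ + b∩) ∎)
  where
  open ≤-Reasoning
  +-interchange = interchange +-commutativeSemigroup
  positive : ∀ c → c ≡ b∩ → 0 < b∩
  positive zero refl = contradiction lt (≤⇒≯ (begin
    a + b        ≤⟨ +-monoˡ-≤ b a≤b ⟩
    b + b        ≡⟨ trans b+b (+-identityʳ b∪) ⟩
    b∪           ≤⟨ m≤n+m b∪ a∩ ⟩
    a∩ + b∪      ∎))
  positive (suc c) refl = s≤s z≤n

-- Involutions exchanging two disjoint sets.

private variable
  m : ℕ
  S T : Subset m

record Exchange (S T : Subset m) : Set where
  field
    to         : Fin m → Fin m
    involutive : ∀ e → to (to e) ≡ e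
    to-right   : ∀ {e} → e ∈ S → to e ∈ T
    to-left    : ∀ {e} → e ∈ T → to e ∈ S
    fixes      : ∀ {e} → e ∉ S → e ∉ T → to e ≡ e

module Override (f : Fin m → Fin m) (f-inv : ∀ e → f (f e) ≡ e) (a b : Fin m) (fa≡a : f a ≡ a) (fb≡b : f b ≡ b) where

  override : Fin m → Fin m
  override e with e ≟ᶠ a
  ... | yes _ = b
  ... | no  _ with e ≟ᶠ b
  ... | yes _ = a
  ... | no  _ = f e

  left : override a ≡ b
  left with a ≟ᶠ a
  ... | yes _ = refl
  ... | no ¬r = contradiction refl ¬r

  right : override b ≡ a
  right with b ≟ᶠ a
  ... | yes b≡a = b≡a
  ... | no  _ with b ≟ᶠ b
  ... | yes _ = refl
  ... | no ¬r = contradiction refl ¬r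

  other : ∀ {e} → e ≢ a → e ≢ b → override e ≡ f e
  other {e} e≢a e≢b with e ≟ᶠ a
  ... | yes e≡a = contradiction e≡a e≢a
  ... | no  _ with e ≟ᶠ b
  ... | yes e≡b = contradiction e≡b e≢b
  ... | no  _ = refl

  -- An involution that fixes `c` sends no other point to `c`, so redefining `f` at `a` and `b` does
  -- not disturb the remaining orbits.
  avoids : ∀ {c e} → f c ≡ c → e ≢ c → f e ≢ c
  avoids {c} {e} fc≡c e≢c fe≡c = e≢c (trans (sym (f-inv e)) (trans (cong f fe≡c) fc≡c))

  involutive : ∀ e → override (override e) ≡ e
  involutive e = go (e ≟ᶠ a) (e ≟ᶠ b)
    where
    go : Dec (e ≡ a) → Dec (e ≡ b) → override (override e) ≡ e
    go (yes refl) _          = trans (cong override left) right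
    go (no _)     (yes refl) = trans (cong override right) left
    go (no e≢a)   (no e≢b)   =
      trans (cong override (other e≢a e≢b))
        (trans (other (avoids fa≡a e≢a) (avoids fb≡b e≢b)) (f-inv e))

-- Both `a` and `b` lie outside the two reduced sets, so `g` fixes them and can be overridden there.
-- This lets an exchange of two blocks pair a prescribed `a` with a prescribed `b`.
exchange-insert : ∀ {a b} → Empty (S ∩ T) → a ∈ S → b ∈ T → Exchange (S - a) (T - b) →
  Σ (Exchange S T) λ g → Exchange.to g a ≡ b × Exchange.to g b ≡ a
exchange-insert {S = S} {T} {a} {b} disj a∈S b∈T g =
  record { to = override ; involutive = involutive ; to-right = right∈ ; to-left = left∈ ; fixes = fixes′ }
  , left , right
  where
  module g = Exchange g
  apart : ∀ {e} → e ∈ S → e ∉ T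
  apart e∈S e∈T = disj (_ , x∈p∩q⁺ (e∈S , e∈T))
  S- : ∀ {e} → e ∈ S - a → e ∈ S
  S- = p─q⊆p S ⁅ a ⁆
  T- : ∀ {e} → e ∈ T - b → e ∈ T
  T- = p─q⊆p T ⁅ b ⁆
  open Override g.to g.involutive a b
    (g.fixes x∉p-x (apart a∈S ∘ T-)) (g.fixes (λ b∈S → apart (S- b∈S) b∈T) x∉p-x)
  right∈ : ∀ {e} → e ∈ S → override e ∈ T
  right∈ {e} e∈S with e ≟ᶠ a
  ... | yes _ = b∈T
  ... | no e≢a with e ≟ᶠ b
  ... | yes refl = contradiction b∈T (apart e∈S)
  ... | no _ = T- (g.to-right (x∈p∧x≢y⇒x∈p-y e∈S e≢a))
  left∈ : ∀ {e} → e ∈ T → override e ∈ S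
  left∈ {e} e∈T with e ≟ᶠ a
  ... | yes refl = contradiction e∈T (apart a∈S)
  ... | no e≢a with e ≟ᶠ b
  ... | yes _ = a∈S
  ... | no e≢b = S- (g.to-left (x∈p∧x≢y⇒x∈p-y e∈T e≢b))
  fixes′ : ∀ {e} → e ∉ S → e ∉ T → override e ≡ e
  fixes′ e∉S e∉T = trans (other (λ { refl → e∉S a∈S }) (λ { refl → e∉T b∈T }))
    (g.fixes (e∉S ∘ S-) (e∉T ∘ T-))

remove-disjoint : ∀ {a b} → Empty (S ∩ T) → Empty ((S - a) ∩ (T - b))
remove-disjoint {S = S} {T} {a} {b} disj (e , e∈) =
  let e∈S , e∈T = x∈p∩q⁻ (S - a) (T - b) e∈ in
  disj (e , x∈p∩q⁺ (p─q⊆p S ⁅ a ⁆ e∈S , p─q⊆p T ⁅ b ⁆ e∈T))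

exchange : ∀ N {S T : Subset m} → ∣ S ∣ ≡ N → ∣ T ∣ ≡ N → Empty (S ∩ T) → Exchange S T
exchange zero {S} {T} S≡0 T≡0 disj = record
  { to = id ; involutive = λ _ → refl ; to-right = λ e∈S → ⊥-elim (empty S≡0 e∈S)
  ; to-left = λ e∈T → ⊥-elim (empty T≡0 e∈T) ; fixes = λ _ _ → refl }
  where
  empty : ∀ {m e} {S : Subset m} → ∣ S ∣ ≡ 0 → e ∉ S
  empty eq e∈S with () ← trans (sym eq) (size-remove e∈S)
exchange (suc N) {S} {T} S≡ T≡ disj =
  let a , a∈S = nonempty-size {S = S} (subst (0 <_) (sym S≡) (s≤s z≤n))
      b , b∈T = nonempty-size {S = T} (subst (0 <_) (sym T≡) (s≤s z≤n))
  in proj₁ (exchange-insert disj a∈S b∈T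
    (exchange N (suc-injective (trans (sym (size-remove a∈S)) S≡))
                (suc-injective (trans (sym (size-remove b∈T)) T≡)) (remove-disjoint disj)))

-- The partition as a colouring, and its symmetries.

module Partition {k m n : ℕ} {X : Fin k → Subset m} (part : IsPartition n X) where

  open IsPartition part

  abstract
    colour-of : ∀ e → ∃ λ i → e ∈ X i
    colour-of e = Any.tabulate⁻ (x∈⋃⁻ _ (subst (e ∈_) (sym covers) ∈⊤))

    colour : Fin m → Fin k
    colour e = proj₁ (colour-of e)

    ∈X : ∀ e → e ∈ X (colour e)
    ∈X e = proj₂ (colour-of e)

  ∈X⇒colour : ∀ {e i} → e ∈ X i → colour e ≡ i
  ∈X⇒colour {e} {i} e∈Xi with colour e ≟ᶠ i
  ... | yes eq  = eq
  ... | no  neq = contradiction (e , x∈p∩q⁺ (∈X e , e∈Xi)) (disjoint neq)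

  colour⇒∈X : ∀ {e i} → colour e ≡ i → e ∈ X i
  colour⇒∈X refl = ∈X _

  Transversal : Subset m → Set
  Transversal S = ∀ {x y} → x ∈ S → y ∈ S → colour x ≡ colour y → x ≡ y

  𝓗⇒transversal : ∀ {p S} → 𝓗 X p S → Transversal S
  𝓗⇒transversal {S = S} (_ , ≤1) {x} {y} x∈S y∈S eq =
    size≤1⁻ (≤1 (colour x)) (x∈p∩q⁺ (x∈S , ∈X x)) (x∈p∩q⁺ (y∈S , colour⇒∈X (sym eq)))

  transversal⇒𝓗 : ∀ {S} → Transversal S → 𝓗 X ∣ S ∣ S
  transversal⇒𝓗 {S} tr = refl , λ i → size≤1 λ x∈ y∈ →
    let x∈S , x∈X = x∈p∩q⁻ S (X i) x∈
        y∈S , y∈X = x∈p∩q⁻ S (X i) y∈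
    in tr x∈S y∈S (trans (∈X⇒colour x∈X) (sym (∈X⇒colour y∈X)))

  classmate : 2 ≤ n → ∀ a → ∃ λ b → colour b ≡ colour a × b ≢ a
  classmate 2≤n a =
    let b , b∈X , b∉ = size-exceeds {S = ⁅ a ⁆} {X (colour a)}
                         (subst₂ _<_ (sym (∣⁅x⁆∣≡1 a)) (sym (size (colour a))) 2≤n)
    in b , ∈X⇒colour b∈X , λ b≡a → b∉ (subst (_∈ ⁅ a ⁆) (sym b≡a) (x∈⁅x⁆ a))

  size-class-remove : ∀ a → n ≡ suc ∣ X (colour a) - a ∣
  size-class-remove a = trans (sym (size (colour a))) (size-remove (∈X a))

  third-classmate : 3 ≤ n → ∀ a b → colour b ≡ colour a →
    ∃ λ c → colour c ≡ colour a × c ≢ a × c ≢ b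
  third-classmate 3≤n a b eq =
    let c , c∈X , c∉ = size-exceeds {S = ⁅ b ⁆} {X (colour a) - a}
          (subst (_< ∣ X (colour a) - a ∣) (sym (∣⁅x⁆∣≡1 b))
            (s≤s⁻¹ (subst (3 ≤_) (size-class-remove a) 3≤n)))
    in c , ∈X⇒colour (p─q⊆p _ ⁅ a ⁆ c∈X) , (λ c≡a → x∉p-x (subst (_∈ X (colour a) - a) c≡a c∈X)) ,
    λ c≡b → c∉ (subst (_∈ ⁅ b ⁆) (sym c≡b) (x∈⁅x⁆ b))

  two-classmates : n ≡ 2 → ∀ {a b c} → colour b ≡ colour a → colour c ≡ colour a →
    b ≢ a → c ≢ a → b ≡ c
  two-classmates n≡2 {a} b~a c~a b≢a c≢a =
    size≤1⁻ (≤-reflexive (suc-injective (trans (sym (size-class-remove a)) n≡2)))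
      (x∈p∧x≢y⇒x∈p-y (colour⇒∈X b~a) b≢a) (x∈p∧x≢y⇒x∈p-y (colour⇒∈X c~a) c≢a)

  record Symmetry : Set where
    field
      to         : Fin m → Fin m
      involutive : ∀ e → to (to e) ≡ e
      respects   : ∀ {x y} → colour x ≡ colour y → colour (to x) ≡ colour (to y)

    injective : ∀ {x y} → to x ≡ to y → x ≡ y
    injective {x} {y} eq = trans (sym (involutive x)) (trans (cong to eq) (involutive y))

    reflects : ∀ {x y} → colour (to x) ≡ colour (to y) → colour x ≡ colour y
    reflects {x} {y} eq = subst₂ (λ u v → colour u ≡ colour v) (involutive x) (involutive y) (respects eq)

  open Symmetry public

  abstract

    -- Written as a preimage, which for an involution is also the image.
    act : Symmetry → Subset m → Subset m
    act f S = tabulate (λ e → lookup S (to f e))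

    ∈act⁺ : ∀ f {S e} → to f e ∈ S → e ∈ act f S
    ∈act⁺ f {S} {e} p = lookup⇒[]= e _ (trans (lookup∘tabulate _ e) ([]=⇒lookup p))

    ∈act⁻ : ∀ f {S e} → e ∈ act f S → to f e ∈ S
    ∈act⁻ f {S} {e} p = lookup⇒[]= (to f e) S (trans (sym (lookup∘tabulate _ e)) ([]=⇒lookup p))

  module _ (f : Symmetry) where

    to∈act : ∀ {S e} → e ∈ S → to f e ∈ act f S
    to∈act {S} {e} e∈S = ∈act⁺ f (subst (_∈ S) (sym (involutive f e)) e∈S)

    act-involutive : ∀ S → act f (act f S) ≡ S
    act-involutive S = ⊆-antisym
      (λ {e} p → subst (_∈ S) (involutive f e) (∈act⁻ f (∈act⁻ f p)))
      (λ {e} p → ∈act⁺ f (to∈act p))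

    act-injective : ∀ {S T} → act f S ≡ act f T → S ≡ T
    act-injective {S} {T} eq = trans (sym (act-involutive S)) (trans (cong (act f) eq) (act-involutive T))

    size-act-≤ : ∀ S → ∣ act f S ∣ ≤ ∣ S ∣
    size-act-≤ S = size-injection (to f) (∈act⁻ f) λ _ _ → injective f

    size-act : ∀ S → ∣ act f S ∣ ≡ ∣ S ∣
    size-act S = ≤-antisym (size-act-≤ S)
      (subst (λ T → ∣ T ∣ ≤ ∣ act f S ∣) (act-involutive S) (size-act-≤ (act f S)))

    size-act-∩ : ∀ S T → ∣ act f S ∩ act f T ∣ ≤ ∣ S ∩ T ∣
    size-act-∩ S T = size-injection (to f)
      (λ e∈ → let e∈S , e∈T = x∈p∩q⁻ (act f S) (act f T) e∈ in x∈p∩q⁺ (∈act⁻ f e∈S , ∈act⁻ f e∈T))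
      λ _ _ → injective f

    𝓗-act : ∀ {p S} → 𝓗 X p S → 𝓗 X p (act f S)
    𝓗-act {p} {S} HS@(∣S∣≡p , _) = trans (size-act S) ∣S∣≡p ,
      proj₂ (transversal⇒𝓗 {act f S} λ x∈ y∈ eq →
        injective f (𝓗⇒transversal HS (∈act⁻ f x∈) (∈act⁻ f y∈) (respects f eq)))

    act-stable : ∀ {S} → (∀ {e} → e ∈ S → to f e ∈ S) → act f S ≡ S
    act-stable {S} closed = ⊆-antisym
      (λ {e} p → subst (_∈ S) (involutive f e) (closed (∈act⁻ f p))) (∈act⁺ f ∘ closed)

  -- Inside one block a transposition serves. Two different blocks have equal size and are exchanged
  -- as wholes, with `a` and `b` paired; this may move all their other elements, hence the proviso
  -- on the fixed points.
  swap-exists : ∀ a b → Σ Symmetry λ f → to f a ≡ b × to f b ≡ a ×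
    (∀ {e} → e ≢ a → e ≢ b → colour a ≡ colour b ⊎ colour e ≢ colour a × colour e ≢ colour b → to f e ≡ e)
  swap-exists a b with colour a ≟ᶠ colour b
  ... | yes a~b = record { to = override ; involutive = O.involutive
                         ; respects = λ {x} {y} eq → trans (kept x) (trans eq (sym (kept y))) }
                , left , right , λ e≢a e≢b _ → other e≢a e≢b
    where
    module O = Override id (λ _ → refl) a b refl refl
    open O using (override; left; right; other)
    kept : ∀ x → colour (override x) ≡ colour x
    kept x with x ≟ᶠ a
    ... | yes refl = sym a~b
    ... | no _ with x ≟ᶠ b
    ... | yes refl = a~b
    ... | no _ = refl
  ... | no a≁b = record { to = E.to ; involutive = E.involutive ; respects = respects′ }
               , proj₁ (proj₂ inserted) , proj₂ (proj₂ inserted)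
               , λ { e≢a e≢b (inj₁ eq) → contradiction eq a≁b
                   ; e≢a e≢b (inj₂ (e≁a , e≁b)) → E.fixes (e≁a ∘ ∈X⇒colour) (e≁b ∘ ∈X⇒colour) }
    where
    i = colour a
    j = colour b
    inserted : Σ (Exchange (X i) (X j)) λ g → Exchange.to g a ≡ b × Exchange.to g b ≡ a
    inserted = exchange-insert (disjoint a≁b) (∈X a) (∈X b)
      (exchange ∣ X i - a ∣ refl
        (suc-injective (trans (sym (size-class-remove b)) (size-class-remove a)))
        (remove-disjoint (disjoint a≁b)))
    module E = Exchange (proj₁ inserted)
    respects′ : ∀ {x y} → colour x ≡ colour y → colour (E.to x) ≡ colour (E.to y)
    respects′ {x} {y} x~y with colour x ≟ᶠ i
    ... | yes x∈i = trans (∈X⇒colour (E.to-right (colour⇒∈X x∈i)))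
                     (sym (∈X⇒colour (E.to-right (colour⇒∈X (trans (sym x~y) x∈i)))))
    ... | no x∉i with colour x ≟ᶠ j
    ... | yes x∈j = trans (∈X⇒colour (E.to-left (colour⇒∈X x∈j)))
                     (sym (∈X⇒colour (E.to-left (colour⇒∈X (trans (sym x~y) x∈j)))))
    ... | no x∉j = trans (cong colour (E.fixes (x∉i ∘ ∈X⇒colour) (x∉j ∘ ∈X⇒colour)))
      (trans x~y (sym (cong colour (E.fixes (x∉i ∘ trans x~y ∘ ∈X⇒colour) (x∉j ∘ trans x~y ∘ ∈X⇒colour)))))

  swap : Fin m → Fin m → Symmetry
  swap a b = proj₁ (swap-exists a b)

  module _ {a b : Fin m} where

    swap-left : to (swap a b) a ≡ b
    swap-left = proj₁ (proj₂ (swap-exists a b))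

    swap-right : to (swap a b) b ≡ a
    swap-right = proj₁ (proj₂ (proj₂ (swap-exists a b)))

    swap-fixes : ∀ {e} → e ≢ a → e ≢ b →
      colour a ≡ colour b ⊎ colour e ≢ colour a × colour e ≢ colour b → to (swap a b) e ≡ e
    swap-fixes = proj₂ (proj₂ (proj₂ (swap-exists a b)))

    -- A transversal has only `a` and `b` in their blocks, so the swap fixes its other elements.
    swap-stabilises-∈ : ∀ {S} → Transversal S → a ∈ S → b ∈ S → act (swap a b) S ≡ S
    swap-stabilises-∈ {S} tr a∈S b∈S = act-stable (swap a b) closed
      where
      closed : ∀ {e} → e ∈ S → to (swap a b) e ∈ S
      closed {e} e∈S with e ≟ᶠ a | e ≟ᶠ b
      ... | yes refl | _        = subst (_∈ S) (sym swap-left) b∈S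
      ... | no _     | yes refl = subst (_∈ S) (sym swap-right) a∈S
      ... | no e≢a   | no e≢b   =
        subst (_∈ S) (sym (swap-fixes e≢a e≢b (inj₂ (e≢a ∘ tr e∈S a∈S , e≢b ∘ tr e∈S b∈S)))) e∈S

    swap-stabilises-∉ : ∀ {S} → colour a ≡ colour b → a ∉ S → b ∉ S → act (swap a b) S ≡ S
    swap-stabilises-∉ {S} a~b a∉S b∉S = act-stable (swap a b) λ e∈S →
      subst (_∈ S) (sym (swap-fixes (λ { refl → a∉S e∈S }) (λ { refl → b∉S e∈S }) (inj₁ a~b))) e∈S

  -- Partners of a single set, and transitivity of the symmetries.

  -- The largest family that can be paired with the singleton of `x`. Both `𝓕₀` and `𝓖ₐ` have this
  -- form.
  Meeting : ℕ → ℕ → Subset m → Family m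
  Meeting q t x G = 𝓗 X q G × t ≤ ∣ G ∩ x ∣

  Meeting? : ∀ q t x → Decidable (Meeting q t x)
  Meeting? q t x G = 𝓗? X q G ×-dec (t ≤? ∣ G ∩ x ∣)

  size-∩-act : ∀ f S T → ∣ S ∩ T ∣ ≤ ∣ act f S ∩ act f T ∣
  size-∩-act f S T = subst₂ (λ U V → ∣ U ∩ V ∣ ≤ ∣ act f S ∩ act f T ∣)
    (act-involutive f S) (act-involutive f T) (size-act-∩ f (act f S) (act f T))

  card-meeting-act : ∀ f q t x → card (Meeting? q t x) ≤ card (Meeting? q t (act f x))
  card-meeting-act f q t x = card-injection (Meeting? q t x) (Meeting? q t (act f x)) (act f)
    (λ {G} (HG , t≤) → 𝓗-act f HG , ≤-trans t≤ (size-∩-act f G x))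
    λ _ _ → act-injective f

  -- Choose `a` in `y` but not in `x`. If `x` has an element `c` in the block of `a`, then `c` is
  -- not in `y`, and transposing the two brings `a` in. Otherwise the block of `a` is exchanged with
  -- that of some `b` in `x` outside `y`. In both cases `x ∩ y` stays fixed pointwise.
  approach : ∀ {p x y} → 𝓗 X p x → 𝓗 X p y → x ≢ y → ∃ λ f → ∣ x ∩ y ∣ < ∣ act f x ∩ y ∣
  approach {p} {x} {y} Hx Hy x≢y = choose
    where
    ∣x∣≡∣y∣ : ∣ x ∣ ≡ ∣ y ∣
    ∣x∣≡∣y∣ = trans (proj₁ Hx) (sym (proj₁ Hy))
    trx = 𝓗⇒transversal Hx
    try = 𝓗⇒transversal Hy
    move : ∀ {a b} → a ∈ y → a ∉ x → b ∈ x → b ∉ y →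
      colour a ≡ colour b ⊎ (∀ {e} → e ∈ x → colour e ≢ colour a) →
      ∃ λ f → ∣ x ∩ y ∣ < ∣ act f x ∩ y ∣
    move {a} {b} a∈y a∉x b∈x b∉y free = f , p⊂q⇒∣p∣<∣q∣
      ( (λ {e} e∈ → let e∈x , e∈y = x∈p∩q⁻ x y e∈ in
          x∈p∩q⁺ (∈act⁺ f (subst (_∈ x) (sym (fixed e∈x e∈y)) e∈x) , e∈y))
      , a , x∈p∩q⁺ (∈act⁺ f (subst (_∈ x) (sym swap-left) b∈x) , a∈y) , a∉x ∘ p∩q⊆p x y )
      where
      f = swap a b
      fixed : ∀ {e} → e ∈ x → e ∈ y → to f e ≡ e
      fixed e∈x e∈y = swap-fixes (λ { refl → a∉x e∈x }) e≢b
        (Sum.map₂ (λ none → none e∈x , e≢b ∘ trx e∈x b∈x) free)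
        where
        e≢b : _ ≢ b
        e≢b refl = b∉y e∈y
    choose : ∃ λ f → ∣ x ∩ y ∣ < ∣ act f x ∩ y ∣
    choose with escapee x y (λ y⊆x → x≢y (sym (⊆∧size≡⇒≡ y⊆x (sym ∣x∣≡∣y∣))))
              | escapee y x (λ x⊆y → x≢y (⊆∧size≡⇒≡ x⊆y ∣x∣≡∣y∣))
    ... | a , a∈y , a∉x | b , b∈x , b∉y
      with any? (λ e → (e ∈? x) ×-dec (colour e ≟ᶠ colour a))
    ... | yes (c , c∈x , c~a) = move a∈y a∉x c∈x
            (λ c∈y → a∉x (subst (_∈ x) (try c∈y a∈y c~a) c∈x)) (inj₁ (sym c~a))
    ... | no none = move a∈y a∉x b∈x b∉y (inj₂ λ e∈x e~a → none (_ , e∈x , e~a))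

  -- Repeated use of `approach` carries `x` to `y`, and no step lowers the count. `N` bounds the
  -- number of elements of `y` still missing.
  card-meeting-transitive : ∀ {p x y} q t → 𝓗 X p x → 𝓗 X p y →
    card (Meeting? q t x) ≤ card (Meeting? q t y)
  card-meeting-transitive {p} {x} {y} q t Hx Hy = go p Hx (m≤m+n p ∣ x ∩ y ∣)
    where
    go : ∀ N {x} → 𝓗 X p x → p ≤ N + ∣ x ∩ y ∣ → card (Meeting? q t x) ≤ card (Meeting? q t y)
    go N {x} Hx near with x ≟ˢ y
    ... | yes refl = ≤-refl
    ... | no x≢y with approach Hx Hy x≢y
    go zero {x} Hx near | no _ | f , closer = contradiction
      (≤-trans (≤-trans closer (∣p∩q∣≤∣q∣ (act f x) y)) (≤-reflexive (proj₁ Hy))) (≤⇒≯ near)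
    go (suc N) {x} Hx near | no _ | f , closer = ≤-trans (card-meeting-act f q t x)
      (go N (𝓗-act f Hx) (≤-trans near
        (≤-trans (≤-reflexive (sym (+-suc N ∣ x ∩ y ∣))) (+-monoʳ-≤ N closer))))

  act-cong : ∀ f g → (∀ e → to f e ≡ to g e) → ∀ S → act f S ≡ act g S
  act-cong f g f≗g S = ⊆-antisym
    (λ {e} e∈ → ∈act⁺ g (subst (_∈ S) (f≗g e) (∈act⁻ f e∈)))
    (λ {e} e∈ → ∈act⁺ f (subst (_∈ S) (sym (f≗g e)) (∈act⁻ g e∈)))

  act-⊆⇒≡ : ∀ f S {T} → ∣ T ∣ ≡ ∣ S ∣ → act f S ⊆ˢ T → act f S ≡ T
  act-⊆⇒≡ f S ∣T∣≡∣S∣ sub = ⊆∧size≡⇒≡ sub (trans (size-act f S) (sym ∣T∣≡∣S∣))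

  -- Blocks of size two: mates and flips.

  module Mates (n≡2 : n ≡ 2) where

    2≤n : 2 ≤ n
    2≤n = ≤-reflexive (sym n≡2)

    abstract

      mate : Fin m → Fin m
      mate e = proj₁ (classmate 2≤n e)

      mate-colour : ∀ e → colour (mate e) ≡ colour e
      mate-colour e = proj₁ (proj₂ (classmate 2≤n e))

      mate≢ : ∀ e → mate e ≢ e
      mate≢ e = proj₂ (proj₂ (classmate 2≤n e))

    mate-unique : ∀ {e c} → colour c ≡ colour e → c ≢ e → c ≡ mate e
    mate-unique {e} c~e c≢e = two-classmates n≡2 c~e (mate-colour e) c≢e (mate≢ e)

    mate-involutive : ∀ e → mate (mate e) ≡ e
    mate-involutive e = sym (mate-unique (sym (mate-colour e)) (mate≢ e ∘ sym))

    mate∉ : ∀ {S e} → Transversal S → e ∈ S → mate e ∉ S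
    mate∉ {e = e} tr e∈S mate∈S = mate≢ e (tr mate∈S e∈S (mate-colour e))

    -- A symmetry maps blocks injectively into blocks, so the other element of a block goes to the
    -- other element of the image block.
    to-mate : ∀ f e → to f (mate e) ≡ mate (to f e)
    to-mate f e = mate-unique (respects f (mate-colour e)) (mate≢ e ∘ injective f)

    module Flip {P : Pred (Fin k) 0ℓ} (P? : Decidable P) where

      abstract

        flipped : Fin m → Fin m
        flipped e = if does (P? (colour e)) then mate e else e

        flip-on : ∀ {e} → P (colour e) → flipped e ≡ mate e
        flip-on {e} p with P? (colour e)
        ... | yes _ = refl
        ... | no ¬p = contradiction p ¬p

        flip-off : ∀ {e} → ¬ P (colour e) → flipped e ≡ e
        flip-off {e} ¬p with P? (colour e)
        ... | yes p = contradiction p ¬p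
        ... | no _  = refl

        flipped-colour : ∀ e → colour (flipped e) ≡ colour e
        flipped-colour e with P? (colour e)
        ... | yes _ = mate-colour e
        ... | no _  = refl

      flipped-involutive : ∀ e → flipped (flipped e) ≡ e
      flipped-involutive e = go (P? (colour e))
        where
        go : Dec (P (colour e)) → flipped (flipped e) ≡ e
        go (yes p) = trans (flip-on (subst P (sym (flipped-colour e)) p))
                       (trans (cong mate (flip-on p)) (mate-involutive e))
        go (no ¬p) = trans (flip-off (¬p ∘ subst P (flipped-colour e))) (flip-off ¬p)

      flip : Symmetry
      flip = record
        { to = flipped
        ; involutive = flipped-involutive
        ; respects = λ {x} {y} x~y → trans (flipped-colour x) (trans x~y (sym (flipped-colour y))) }

    open Flip using (flip; flip-on; flip-off) public

    pair? : ∀ u w → Decidable (λ i → i ≡ colour u ⊎ i ≡ colour w)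
    pair? u w i = (i ≟ᶠ colour u) ⊎-dec (i ≟ᶠ colour w)

    flip₂ : Fin m → Fin m → Symmetry
    flip₂ u w = flip (pair? u w)

    flip₂-cong : ∀ {u w u′ w′} →
      (∀ {i} → i ≡ colour u ⊎ i ≡ colour w → i ≡ colour u′ ⊎ i ≡ colour w′) →
      (∀ {i} → i ≡ colour u′ ⊎ i ≡ colour w′ → i ≡ colour u ⊎ i ≡ colour w) →
      ∀ S → act (flip₂ u w) S ≡ act (flip₂ u′ w′) S
    flip₂-cong {u} {w} {u′} {w′} forth back = act-cong (flip₂ u w) (flip₂ u′ w′) pointwise
      where
      pointwise : ∀ e → to (flip₂ u w) e ≡ to (flip₂ u′ w′) e
      pointwise e with pair? u w (colour e)
      ... | yes p = trans (flip-on (pair? u w) p) (sym (flip-on (pair? u′ w′) (forth p)))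
      ... | no ¬p = trans (flip-off (pair? u w) ¬p) (sym (flip-off (pair? u′ w′) (¬p ∘ back)))

  -- Families preserved by every symmetry that maps a member to a member.

  module Block {p q t : ℕ} (1≤t : 1 ≤ t) (2≤n : 2 ≤ n) {𝓐 𝓑 : Family m}
    (𝓐? : Decidable 𝓐) (𝓑? : Decidable 𝓑) (𝓐⊆ : 𝓐 ⊆ 𝓗 X p) (𝓑⊆ : 𝓑 ⊆ 𝓗 X q)
    (cross : CrossIntersecting t 𝓐 𝓑)
    (block : ∀ f {z w} → 𝓐 z → 𝓐 (act f z) → 𝓐 w → 𝓐 (act f w))
    {G : Subset m} (G∈ : 𝓑 G) where

    trans𝓐 : ∀ {z} → 𝓐 z → Transversal z
    trans𝓐 = 𝓗⇒transversal ∘ 𝓐⊆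

    size𝓐 : ∀ {z w} → 𝓐 z → 𝓐 w → ∣ z ∣ ≡ ∣ w ∣
    size𝓐 z∈ w∈ = trans (proj₁ (𝓐⊆ z∈)) (sym (proj₁ (𝓐⊆ w∈)))

    G-transversal : Transversal G
    G-transversal = 𝓗⇒transversal (𝓑⊆ G∈)

    difference : ∀ {z w} → 𝓐 z → 𝓐 w → w ≢ z → ∃ λ a → a ∈ z × a ∉ w
    difference {z} {w} z∈ w∈ w≢z =
      escapee w z λ z⊆w → w≢z (sym (⊆∧size≡⇒≡ z⊆w (size𝓐 z∈ w∈)))

    -- A member fixed by `f` is a point where 𝓐 meets its image, so `block` applies.
    stabiliser : ∀ f {z w} → 𝓐 z → act f z ≡ z → 𝓐 w → 𝓐 (act f w)
    stabiliser f z∈ eq = block f z∈ (subst 𝓐 (sym eq) z∈)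

    -- 𝓑 lies inside `Meeting q t z`, and `h` finds room for the members of 𝓐 other than `z` in the
    -- rest of `Meeting q t z`. Only `z` itself remains to be counted.
    card-bound : ∀ {z} → 𝓐 z → (h : Subset m → Subset m) →
      (∀ {w} → 𝓐 w → w ≢ z → Meeting q t z (h w) × ¬ 𝓑 (h w)) →
      (∀ {w w′} → 𝓐 w × w ≢ z → 𝓐 w′ × w′ ≢ z → h w ≡ h w′ → w ≡ w′) →
      card 𝓐? + card 𝓑? ≤ suc (card (Meeting? q t z))
    card-bound {z} z∈ h into inj = begin
      card 𝓐? + card 𝓑?                ≤⟨ +-monoˡ-≤ (card 𝓑?) (card-remove 𝓐? z) ⟩
      suc (card 𝓐∖z? + card 𝓑?)        ≤⟨ s≤s (+-monoˡ-≤ (card 𝓑?)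
                                           (card-injection 𝓐∖z? rest? h (λ (w∈ , w≢z) → into w∈ w≢z) inj)) ⟩
      suc (card rest? + card 𝓑?)       ≡⟨ cong suc (card-∪-∩ rest? 𝓑?) ⟩
      suc (card (rest? ∪? 𝓑?) + card (rest? ∩? 𝓑?))
        ≡⟨ cong (λ c → suc (card (rest? ∪? 𝓑?) + c))
             (card-empty (rest? ∩? 𝓑?) (λ ((_ , ∉𝓑) , ∈𝓑) → ∉𝓑 ∈𝓑)) ⟩
      suc (card (rest? ∪? 𝓑?) + 0)     ≡⟨ cong suc (+-identityʳ _) ⟩
      suc (card (rest? ∪? 𝓑?))         ≤⟨ s≤s (card-mono (rest? ∪? 𝓑?) (Meeting? q t z) [ proj₁ , meets ]′) ⟩
      suc (card (Meeting? q t z))      ∎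
      where
      open ≤-Reasoning
      𝓐∖z? = 𝓐? ∩? ∁? (_≟ˢ z)
      rest? = Meeting? q t z ∩? ∁? 𝓑?
      meets : ∀ {F} → 𝓑 F → Meeting q t z F
      meets {F} F∈ = 𝓑⊆ F∈ , subst (λ S → t ≤ ∣ S ∣) (∩-comm z F) (cross z∈ F∈)

    record Neighbours (a b : Fin m) (z w : Subset m) : Set where
      field
        a∈z   : a ∈ z
        b∈w   : b ∈ w
        a≢b   : a ≢ b
        a~b   : colour a ≡ colour b
        agree : ∀ {e} → e ≢ a → e ≢ b → e ∈ z → e ∈ w
        agree⁻ : ∀ {e} → e ≢ a → e ≢ b → e ∈ w → e ∈ z

    open Neighbours

    reverse : ∀ {a b z w} → Neighbours a b z w → Neighbours b a w z
    reverse nb = record { a∈z = nb .b∈w ; b∈w = nb .a∈z ; a≢b = nb .a≢b ∘ sym ; a~b = sym (nb .a~b)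
                        ; agree = λ p q → nb .agree⁻ q p ; agree⁻ = λ p q → nb .agree q p }

    -- The swap of `a` and `u` fixes `z` and hence preserves 𝓐. It moves the place where `w` departs
    -- from `z` from the block of `a` to that of `u`.
    recentre : ∀ {a b z w u} → 𝓐 z → 𝓐 w → Neighbours a b z w → u ∈ z →
      ∃ λ c → ∃ λ v → 𝓐 v × Neighbours u c z v
    recentre {a} {b} {z} {w} {u} z∈ w∈ nb u∈z =
      to f b , act f w , stabiliser f z∈ fz≡z w∈ , record
        { a∈z = u∈z
        ; b∈w = to∈act f (nb .b∈w)
        ; a≢b = λ u≡fb → nb .a≢b (injective f (trans swap-left u≡fb))
        ; a~b = subst (λ v → colour v ≡ colour (to f b)) swap-left (respects f (nb .a~b))
        ; agree = λ e≢u e≢fb e∈z → ∈act⁺ f (nb .agree (off-a e≢u) (off-b e≢fb) (to∈z e∈z))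
        ; agree⁻ = λ {e} e≢u e≢fb e∈ → subst (e ∈_) fz≡z
            (∈act⁺ f (nb .agree⁻ (off-a e≢u) (off-b e≢fb) (∈act⁻ f e∈))) }
      where
      f = swap a u
      fz≡z : act f z ≡ z
      fz≡z = swap-stabilises-∈ (trans𝓐 z∈) (nb .a∈z) u∈z
      to∈z : ∀ {e} → e ∈ z → to f e ∈ z
      to∈z {e} e∈z = ∈act⁻ f (subst (e ∈_) (sym fz≡z) e∈z)
      off-a : ∀ {e} → e ≢ u → to f e ≢ a
      off-a e≢u fe≡a = e≢u (injective f (trans fe≡a (sym swap-right)))
      off-b : ∀ {e} → e ≢ to f b → to f e ≢ b
      off-b {e} e≢fb fe≡b = e≢fb (trans (sym (involutive f e)) (cong (to f) fe≡b))

    -- Recentre at some `u` in `z ∩ G`. The new member `v` has another element of the same block in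
    -- place of `u`, and the transversal `G` misses it. So `u` is lost from the intersection,
    -- nothing is gained, and `v` and `z` are neighbours for the next round.
    descend : ∀ {a b z w} → 𝓐 z → 𝓐 w → Neighbours a b z w →
      ∃ λ c → ∃ λ u → ∃ λ v → 𝓐 v × Neighbours c u v z × ∣ v ∩ G ∣ < ∣ z ∩ G ∣
    descend {z = z} z∈ w∈ nb with nonempty-∩ 1≤t (cross z∈ G∈)
    ... | u , u∈z , u∈G with recentre z∈ w∈ nb u∈z
    ... | c , v , v∈ , nb′ = c , u , v , v∈ , reverse nb′ , p⊂q⇒∣p∣<∣q∣
      ( (λ {e} e∈ → let e∈v , e∈G = x∈p∩q⁻ v G e∈ in x∈p∩q⁺ (nb′ .agree⁻
          (λ { refl → nb′ .a≢b (trans𝓐 v∈ e∈v (nb′ .b∈w) (nb′ .a~b)) })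
          (λ { refl → nb′ .a≢b (G-transversal u∈G e∈G (nb′ .a~b)) }) e∈v , e∈G))
      , u , x∈p∩q⁺ (u∈z , u∈G)
      , λ u∈ → nb′ .a≢b (trans𝓐 v∈ (p∩q⊆p v G u∈) (nb′ .b∈w) (nb′ .a~b)) )

    -- Every descent lowers the size of an intersection with `G`, so it cannot be repeated forever.
    no-neighbours : ∀ {a b z w} → 𝓐 z → 𝓐 w → ¬ Neighbours a b z w
    no-neighbours z₀∈ w₀∈ nb₀ = go _ z₀∈ w₀∈ nb₀ ≤-refl
      where
      go : ∀ N {a b z w} → 𝓐 z → 𝓐 w → Neighbours a b z w → ¬ (∣ z ∩ G ∣ ≤ N)
      go N z∈ w∈ nb ≤N with descend z∈ w∈ nb
      go zero    z∈ w∈ nb ≤0 | _ , _ , _ , _ , _ , smaller = n≮0 (≤-trans smaller ≤0)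
      go (suc N) z∈ w∈ nb ≤N | _ , _ , _ , v∈ , nb′ , smaller =
        go N v∈ z∈ nb′ (≤-pred (≤-trans smaller ≤N))

    -- If `x` contained neither `a` nor `c`, their transposition would fix `x` and hence preserve 𝓐,
    -- making its image of `y` a neighbour of `y`.
    no-free-pair : ∀ {x y a c} → 𝓐 x → 𝓐 y → a ∈ y → a ∉ x → colour a ≡ colour c → a ≢ c → ¬ (c ∉ x)
    no-free-pair {x} {y} {a} {c} x∈ y∈ a∈y a∉x a~c a≢c c∉x =
      no-neighbours y∈ (stabiliser f x∈ (swap-stabilises-∉ a~c a∉x c∉x) y∈) record
        { a∈z = a∈y
        ; b∈w = ∈act⁺ f (subst (_∈ y) (sym swap-right) a∈y)
        ; a≢b = a≢c
        ; a~b = a~c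
        ; agree = λ e≢a e≢c e∈y → ∈act⁺ f (subst (_∈ y) (sym (swap-fixes e≢a e≢c (inj₁ a~c))) e∈y)
        ; agree⁻ = λ e≢a e≢c e∈ → subst (_∈ y) (swap-fixes e≢a e≢c (inj₁ a~c)) (∈act⁻ f e∈) }
      where f = swap a c

    -- The total is assumed to exceed that of each pair formed by a singleton of a member `z` and
    -- `Meeting q t z`; any application of `card-bound` is then a contradiction.
    module _ (too-big : ∀ {z} → 𝓐 z → ¬ (card 𝓐? + card 𝓑? ≤ suc (card (Meeting? q t z)))) where

      not-singleton : ∀ {z} → 𝓐 z → ¬ (∀ {w} → 𝓐 w → w ≡ z)
      -- There is no `w` other than `z`, so the choice of `id` is immaterial.
      not-singleton z∈ only = too-big z∈ (card-bound z∈ id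
        (λ w∈ w≢z → contradiction (only w∈) w≢z)
        λ (w∈ , w≢z) → contradiction (only w∈) w≢z)

      -- The transversal `z` has at most one element in the block of `a`. With three elements in the
      -- block, one besides `a` avoids `z`, against `no-free-pair`.
      impossible-n≥3 : 3 ≤ n → ∀ {z} → ¬ 𝓐 z
      impossible-n≥3 3≤n {z} z∈ = not-singleton z∈ λ {w} w∈ →
        decidable-stable (w ≟ˢ z) λ w≢z → differ w∈ (difference w∈ z∈ (w≢z ∘ sym))
        where
        differ : ∀ {w} → 𝓐 w → ¬ (∃ λ a → a ∈ w × a ∉ z)
        differ w∈ (a , a∈w , a∉z) with any? (λ e → (e ∈? z) ×-dec (colour e ≟ᶠ colour a))
        ... | no none = let c , c~a , c≢a = classmate 2≤n a in
          no-free-pair z∈ w∈ a∈w a∉z (sym c~a) (c≢a ∘ sym) λ c∈z → none (c , c∈z , c~a)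
        ... | yes (b , b∈z , b~a) = let c , c~a , c≢a , c≢b = third-classmate 3≤n a b b~a in
          no-free-pair z∈ w∈ a∈w a∉z (sym c~a) (c≢a ∘ sym)
            λ c∈z → c≢b (trans𝓐 z∈ c∈z b∈z (trans c~a (sym b~a)))

      -- Excluding blocks of size two.

      module Binary (n≡2 : n ≡ 2) where

        open Mates n≡2 hiding (2≤n)

        -- The mate is the only other element of the block, so `no-free-pair` forces it into `x`.
        -- Consequently all members of 𝓐 meet the same blocks.
        common-colours : ∀ {x y a} → 𝓐 x → 𝓐 y → a ∈ y → a ∉ x → mate a ∈ x
        common-colours {x} {a = a} x∈ y∈ a∈y a∉x = decidable-stable (mate a ∈? x)
          (no-free-pair x∈ y∈ a∈y a∉x (sym (mate-colour a)) (mate≢ a ∘ sym))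

        common-colours′ : ∀ {x y a} → 𝓐 x → 𝓐 y → a ∈ y → ∃ λ b → b ∈ x × colour b ≡ colour a
        common-colours′ {x} {a = a} x∈ y∈ a∈y with a ∈? x
        ... | yes a∈x = a , a∈x , refl
        ... | no  a∉x = mate a , common-colours x∈ y∈ a∈y a∉x , mate-colour a

        -- Both `e` and the mate of `a` are in `x`, so their swap preserves 𝓐. It sends `e` to the
        -- mate of `a` and `a` to the mate of `e`; on `y`, which contains `e` and `a`, this amounts
        -- to flipping both blocks.
        flip₂-of-meeting : ∀ {x y e a} → 𝓐 x → 𝓐 y → e ∈ x → e ∈ y → a ∈ y → a ∉ x →
          𝓐 (act (flip₂ e a) y)
        flip₂-of-meeting {x} {y} {e} {a} x∈ y∈ e∈x e∈y a∈y a∉x = subst 𝓐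
          (act-⊆⇒≡ f y (size-act (flip₂ e a) y) sub)
          (stabiliser f x∈ (swap-stabilises-∈ (trans𝓐 x∈) e∈x b∈x) y∈)
          where
          b = mate a
          f = swap e b
          b∈x = common-colours x∈ y∈ a∈y a∉x
          try = trans𝓐 y∈
          fa≡ : to f a ≡ mate e
          fa≡ = trans (cong (to f) (sym (mate-involutive a)))
                  (trans (to-mate f b) (cong mate swap-right))
          sub : act f y ⊆ˢ act (flip₂ e a) y
          sub {c} c∈ = ∈act⁺ (flip₂ e a) (cases (∈act⁻ f c∈))
            where
            cases : to f c ∈ y → to (flip₂ e a) c ∈ y
            cases fc∈y with colour c ≟ᶠ colour e
            ... | yes c~e = subst (_∈ y) (sym (trans (flip-on (pair? e a) (inj₁ c~e)) mc≡e)) e∈y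
              where
              c≢e : c ≢ e
              c≢e refl = mate∉ try a∈y (subst (_∈ y) swap-left fc∈y)
              mc≡e : mate c ≡ e
              mc≡e = trans (cong mate (mate-unique c~e c≢e)) (mate-involutive e)
            ... | no c≁e with colour c ≟ᶠ colour a
            ... | yes c~a = subst (_∈ y) (sym (trans (flip-on (pair? e a) (inj₂ c~a)) mc≡a)) a∈y
              where
              c≢a : c ≢ a
              c≢a refl = mate∉ try e∈y (subst (_∈ y) fa≡ fc∈y)
              mc≡a : mate c ≡ a
              mc≡a = trans (cong mate (mate-unique c~a c≢a)) (mate-involutive a)
            ... | no c≁a = subst (_∈ y) (trans (swap-fixes (c≁e ∘ cong colour)
                    (λ c≡b → c≁a (trans (cong colour c≡b) (mate-colour a)))
                    (inj₂ (c≁e , λ c~b → c≁a (trans c~b (mate-colour a)))))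
                    (sym (flip-off (pair? e a) [ c≁e , c≁a ]′))) fc∈y

        flip₂-sym : ∀ {u w z} → 𝓐 (act (flip₂ u w) z) → 𝓐 (act (flip₂ w u) z)
        flip₂-sym {z = z} = subst 𝓐 (flip₂-cong Sum.swap Sum.swap z)

        -- The swap of `a` and `u` fixes the set `z` and the element `w`, and conjugates the flip at
        -- `a` and `w` into the flip at `u` and `w`.
        flip₂-move : ∀ {z a u w} → 𝓐 z → a ∈ z → u ∈ z → w ∈ z → a ≢ w → u ≢ w →
          𝓐 (act (flip₂ a w) z) → 𝓐 (act (flip₂ u w) z)
        flip₂-move {z} {a} {u} {w} z∈ a∈z u∈z w∈z a≢w u≢w flipped = subst 𝓐
          (act-⊆⇒≡ f z′ (trans (size-act (flip₂ u w) z) (sym (size-act (flip₂ a w) z))) sub)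
          (stabiliser f z∈ fz≡z flipped)
          where
          f = swap a u
          z′ = act (flip₂ a w) z
          trz = trans𝓐 z∈
          fz≡z : act f z ≡ z
          fz≡z = swap-stabilises-∈ trz a∈z u∈z
          fw≡w : to f w ≡ w
          fw≡w = swap-fixes (a≢w ∘ sym) (u≢w ∘ sym) (inj₂ (a≢w ∘ sym ∘ trz w∈z a∈z , u≢w ∘ sym ∘ trz w∈z u∈z))
          commutes : ∀ c → to (flip₂ a w) (to f c) ≡ to f (to (flip₂ u w) c)
          commutes c with pair? u w (colour c)
          ... | yes p = trans (flip-on (pair? a w) ([ inj₁ ∘ toward swap-right , inj₂ ∘ toward fw≡w ]′ p))
                          (trans (sym (to-mate f c)) (cong (to f) (sym (flip-on (pair? u w) p))))
            where
            toward : ∀ {v v′} → to f v ≡ v′ → colour c ≡ colour v → colour (to f c) ≡ colour v′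
            toward fv≡v′ c~v = trans (respects f c~v) (cong colour fv≡v′)
          ... | no ¬p = trans (flip-off (pair? a w) (¬p ∘ [ inj₁ ∘ back swap-right , inj₂ ∘ back fw≡w ]′))
                          (cong (to f) (sym (flip-off (pair? u w) ¬p)))
            where
            back : ∀ {v v′} → to f v ≡ v′ → colour (to f c) ≡ colour v′ → colour c ≡ colour v
            back fv≡v′ fc~v′ = reflects f (trans fc~v′ (cong colour (sym fv≡v′)))
          sub : act f z′ ⊆ˢ act (flip₂ u w) z
          sub {c} c∈ = ∈act⁺ (flip₂ u w) (subst (to (flip₂ u w) c ∈_) fz≡z (∈act⁺ f
            (subst (_∈ z) (commutes c) (∈act⁻ (flip₂ a w) (∈act⁻ f c∈)))))

        -- Two distinct members with a common element allow one flip of two blocks. By `block` this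
        -- flip preserves 𝓐, and `flip₂-move` carries it to every other pair of blocks met by `z`.
        flip₂-closed : ∀ {x y e} → 𝓐 x → 𝓐 y → x ≢ y → e ∈ x → e ∈ y →
          ∀ {z u w} → 𝓐 z → u ∈ z → w ∈ z → u ≢ w → 𝓐 (act (flip₂ u w) z)
        flip₂-closed {x} {y} {e} x∈ y∈ x≢y e∈x e∈y {z} {u} {w} z∈ u∈z w∈z u≢w
          with difference y∈ x∈ x≢y
        ... | a , a∈y , a∉x
          with common-colours′ z∈ y∈ e∈y | common-colours′ z∈ y∈ a∈y
        ... | e′ , e′∈z , e′~e | a′ , a′∈z , a′~a = go (u ≟ᶠ a′)
          where
          e′≢a′ : e′ ≢ a′
          e′≢a′ refl = a∉x (subst (_∈ x) (trans𝓐 y∈ e∈y a∈y (trans (sym e′~e) a′~a)) e∈x)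
          base : 𝓐 (act (flip₂ e′ a′) z)
          base = subst 𝓐
            (flip₂-cong [ (λ p → inj₁ (trans p (sym e′~e))) , (λ p → inj₂ (trans p (sym a′~a))) ]′
                        [ (λ p → inj₁ (trans p e′~e)) , (λ p → inj₂ (trans p a′~a)) ]′ z)
            (block (flip₂ e a) y∈ (flip₂-of-meeting x∈ y∈ e∈x e∈y a∈y a∉x) z∈)
          -- Starting from `e′` and `a′`, first `e′` is moved to `u` and then `a′` to `w`. If `u` is
          -- already `a′`, only `e′` is moved, to `w`.
          go : Dec (u ≡ a′) → 𝓐 (act (flip₂ u w) z)
          go (yes refl) = flip₂-sym (flip₂-move z∈ e′∈z w∈z u∈z e′≢a′ (u≢w ∘ sym) base)
          go (no u≢a′) = flip₂-sym (flip₂-move z∈ a′∈z w∈z u∈z (u≢a′ ∘ sym) (u≢w ∘ sym)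
            (flip₂-sym (flip₂-move z∈ e′∈z u∈z a′∈z e′≢a′ u≢a′ base)))

        -- In every block met by `z` other than that of `u`, the set `G` takes the element opposite
        -- to `z`. So `z` and `G` meet in `u` alone.
        record Critical : Set where
          field
            {z} {u} : _
            z∈𝓐 : 𝓐 z
            u∈z : u ∈ z
            u∈G : u ∈ G
            mates∈G : ∀ {w} → w ∈ z → w ≢ u → mate w ∈ G

        -- If some other `w` in `z` has its mate outside `G`, flip `z` at `u` and `w`: this loses
        -- `u` and gains nothing in `G`, which holds neither mate. The process stops at a critical
        -- member.
        find-critical : (∀ {z u w} → 𝓐 z → u ∈ z → w ∈ z → u ≢ w → 𝓐 (act (flip₂ u w) z)) →
          ∀ N {z} → 𝓐 z → ∣ z ∩ G ∣ ≤ N → Critical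
        find-critical closed N {z} z∈ ≤N with nonempty-∩ 1≤t (cross z∈ G∈)
        ... | u , u∈z , u∈G with any? (λ w → (w ∈? z) ×-dec (¬? (w ≟ᶠ u)) ×-dec ¬? (mate w ∈? G))
        ... | no none = record { z∈𝓐 = z∈ ; u∈z = u∈z ; u∈G = u∈G ; mates∈G = λ {w} w∈z w≢u →
                decidable-stable (mate w ∈? G) λ ∉G → none (w , w∈z , w≢u , ∉G) }
        find-critical closed zero {z} z∈ ≤0 | u , u∈z , u∈G | yes _ =
          contradiction (≤-trans (size>0 (x∈p∩q⁺ (u∈z , u∈G))) ≤0) n≮0
        find-critical closed (suc N) {z} z∈ ≤N | u , u∈z , u∈G | yes (w , w∈z , w≢u , mw∉G) =
          find-critical closed N (closed z∈ u∈z w∈z (w≢u ∘ sym)) (≤-pred (≤-trans (p⊂q⇒∣p∣<∣q∣ smaller) ≤N))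
          where
          f = flip₂ u w
          trz = trans𝓐 z∈
          smaller : act f z ∩ G ⊂ z ∩ G
          smaller = (λ {e} e∈ → let e∈fz , e∈G = x∈p∩q⁻ (act f z) G e∈ in
                       x∈p∩q⁺ (stays (∈act⁻ f e∈fz) e∈G , e∈G))
                  , u , x∈p∩q⁺ (u∈z , u∈G)
                  , λ u∈ → mate∉ trz u∈z (subst (_∈ z) (flip-on (pair? u w) (inj₁ refl))
                                           (∈act⁻ f (p∩q⊆p (act f z) G u∈)))
            where
            stays : ∀ {e} → to f e ∈ z → e ∈ G → e ∈ z
            stays {e} fe∈z e∈G with colour e ≟ᶠ colour u
            ... | yes e~u = subst (_∈ z) (G-transversal u∈G e∈G (sym e~u)) u∈z
            ... | no e≁u with colour e ≟ᶠ colour w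
            ... | no e≁w = subst (_∈ z) (flip-off (pair? u w) [ e≁u , e≁w ]′) fe∈z
            ... | yes e~w with e ≟ᶠ w
            ... | yes refl = w∈z
            ... | no e≢w = contradiction (subst (_∈ G) (mate-unique e~w e≢w) e∈G) mw∉G

        module FromCritical (crit : Critical) where

          open Critical crit

          f₀ : Symmetry
          f₀ = flip (_≟ᶠ colour u)

          -- `G` with `u` replaced by its mate; on the blocks met by `z` it is the complement of
          -- `z`.
          G₀ : Subset m
          G₀ = act f₀ G

          mates∈G₀ : ∀ {w} → w ∈ z → mate w ∈ G₀
          mates∈G₀ {w} w∈z with w ≟ᶠ u
          ... | yes refl = ∈act⁺ f₀ (subst (_∈ G)
                  (sym (trans (flip-on (_≟ᶠ colour u) (mate-colour u)) (mate-involutive u))) u∈G)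
          ... | no w≢u = ∈act⁺ f₀ (subst (_∈ G)
                  (sym (flip-off (_≟ᶠ colour u) λ mw~u →
                    w≢u (trans𝓐 z∈𝓐 w∈z u∈z (trans (sym (mate-colour w)) mw~u))))
                  (mates∈G w∈z w≢u))

          t≤1 : t ≤ 1
          t≤1 = ≤-trans (cross z∈𝓐 G∈) (size≤1 λ x∈ y∈ → trans (is-u x∈) (sym (is-u y∈)))
            where
            is-u : ∀ {w} → w ∈ z ∩ G → w ≡ u
            is-u {w} w∈ = let w∈z , w∈G = x∈p∩q⁻ z G w∈ in
              decidable-stable (w ≟ᶠ u) λ w≢u → mate∉ G-transversal w∈G (mates∈G w∈z w≢u)

          differs? : ∀ w → Decidable (λ i → ∃ λ e → e ∈ z × e ∉ w × colour e ≡ i)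
          differs? w i = any? λ e → (e ∈? z) ×-dec ¬? (e ∈? w) ×-dec (colour e ≟ᶠ i)

          -- h w is G₀ moved by the colour flips carrying z to w.
          h : Subset m → Subset m
          h w = act (flip (differs? w)) G₀

          h-𝓗 : ∀ w → 𝓗 X q (h w)
          h-𝓗 w = 𝓗-act (flip (differs? w)) (𝓗-act f₀ (𝓑⊆ G∈))

          -- `G₀` holds the mates of `z`. Flipping the blocks where `z` and `w` differ turns these
          -- into the mates of `w`.
          mates∈h : ∀ {w c} → 𝓐 w → c ∈ w → mate c ∈ h w
          mates∈h {w} {c} w∈ c∈w with c ∈? z
          ... | yes c∈z = ∈act⁺ (flip (differs? w)) (subst (_∈ G₀)
                  (sym (flip-off (differs? w) λ (e , e∈z , e∉w , e~mc) →
                    e∉w (subst (_∈ w) (trans𝓐 z∈𝓐 c∈z e∈z (sym (trans e~mc (mate-colour c)))) c∈w)))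
                  (mates∈G₀ c∈z))
          ... | no c∉z = let mc∈z = common-colours z∈𝓐 w∈ c∈w c∉z in
                ∈act⁺ (flip (differs? w)) (subst (_∈ G₀)
                  (sym (flip-on (differs? w) (mate c , mc∈z , mate∉ (trans𝓐 w∈) c∈w , refl)))
                  (mates∈G₀ mc∈z))

          h-disjoint : ∀ {w c} → 𝓐 w → c ∈ w → c ∉ h w
          h-disjoint {w} w∈ c∈w c∈h = mate∉ (𝓗⇒transversal (h-𝓗 w)) c∈h (mates∈h w∈ c∈w)

          -- Where `w` differs from `z`, the mates of `w` belong to `z`, and by `t≤1` one such
          -- element is enough. On the other hand `h w` misses `w` entirely, which keeps it out of
          -- 𝓑.
          h-into : ∀ {w} → 𝓐 w → w ≢ z → Meeting q t z (h w) × ¬ 𝓑 (h w)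
          h-into {w} w∈ w≢z with difference z∈𝓐 w∈ w≢z
          ... | e , e∈z , e∉w = (h-𝓗 w , ≤-trans t≤1 (size>0 (x∈p∩q⁺ (e∈h , e∈z))))
                              , λ h∈ → let c , c∈w , c∈h = nonempty-∩ 1≤t (cross w∈ h∈) in
                                  h-disjoint w∈ c∈w c∈h
            where
            e∈h : e ∈ h w
            e∈h = ∈act⁺ (flip (differs? w)) (subst (_∈ G₀)
              (sym (flip-on (differs? w) (e , e∈z , e∉w , refl))) (mates∈G₀ e∈z))

          -- On the blocks met by 𝓐, `h w` consists of the mates of `w`, from which `w` can be read
          -- off.
          h-injective : ∀ {w w′} → 𝓐 w → 𝓐 w′ → h w ≡ h w′ → w ≡ w′
          h-injective {w} {w′} w∈ w′∈ hw≡hw′ = ⊆∧size≡⇒≡ sub (size𝓐 w∈ w′∈)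
            where
            sub : w ⊆ˢ w′
            sub {c} c∈w = decidable-stable (c ∈? w′) λ c∉w′ →
              h-disjoint w′∈ (common-colours w′∈ w∈ c∈w c∉w′) (subst (mate c ∈_) hw≡hw′ (mates∈h w∈ c∈w))

          impossible : ⊥
          impossible = too-big z∈𝓐 (card-bound z∈𝓐 h h-into
            λ (w∈ , _) (w′∈ , _) → h-injective w∈ w′∈)

        disjoint-members : ∀ {x y e} → 𝓐 x → 𝓐 y → x ≢ y → e ∈ x → e ∉ y
        disjoint-members x∈ y∈ x≢y e∈x e∈y = FromCritical.impossible
          (find-critical (flip₂-closed x∈ y∈ x≢y e∈x e∈y) _ x∈ ≤-refl)

        -- Distinct members are disjoint and meet the same blocks, so any member besides `x`
        -- consists of the mates of `x`. There is at most one.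
        impossible-n≡2 : ∀ {x} → ¬ 𝓐 x
        impossible-n≡2 {x} x∈ = not-singleton x∈ λ {y} y∈ →
          decidable-stable (y ≟ˢ x) λ y≢x → another y∈ (y≢x ∘ sym)
          where
          another : ∀ {y} → 𝓐 y → ¬ (x ≢ y)
          -- With only `y` besides `x`, a constant map is injective. Its value `G*` is `G` flipped
          -- in the blocks where it meets `y`: it misses `y` but keeps all of `x ∩ G`.
          another {y} y∈ x≢y = too-big x∈ (card-bound x∈ (λ _ → G*) (λ _ _ → meets , G*∉𝓑)
            λ (w∈ , w≢x) (w′∈ , w′≢x) _ → ⊆∧size≡⇒≡ (sub w∈ w≢x w′∈ w′≢x) (size𝓐 w∈ w′∈))
            where
            in-y∩G? : Decidable (λ i → ∃ λ e → e ∈ y × e ∈ G × colour e ≡ i)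
            in-y∩G? i = any? λ e → (e ∈? y) ×-dec (e ∈? G) ×-dec (colour e ≟ᶠ i)
            f = flip in-y∩G?
            G* = act f G
            meets : Meeting q t x G*
            meets = 𝓗-act f (𝓑⊆ G∈) , ≤-trans (cross x∈ G∈) (p⊆q⇒∣p∣≤∣q∣ λ {c} c∈ →
              let c∈x , c∈G = x∈p∩q⁻ x G c∈ in
              x∈p∩q⁺ (∈act⁺ f (subst (_∈ G) (sym (flip-off in-y∩G? λ (e , e∈y , e∈G , e~c) →
                disjoint-members x∈ y∈ x≢y c∈x (subst (_∈ y) (G-transversal e∈G c∈G e~c) e∈y))) c∈G) , c∈x))
            G*∉𝓑 : ¬ 𝓑 G*
            G*∉𝓑 G*∈ with nonempty-∩ 1≤t (cross y∈ G*∈)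
            ... | c , c∈y , c∈G* = case in-y∩G? (colour c) of λ
              { (yes p@(e , e∈y , e∈G , e~c)) → mate∉ G-transversal
                  (subst (_∈ G) (trans𝓐 y∈ e∈y c∈y e~c) e∈G)
                  (subst (_∈ G) (flip-on in-y∩G? p) (∈act⁻ f c∈G*))
              ; (no ¬p) → ¬p (c , c∈y , subst (_∈ G) (flip-off in-y∩G? ¬p) (∈act⁻ f c∈G*) , refl) }
            sub : ∀ {w w′} → 𝓐 w → w ≢ x → 𝓐 w′ → w′ ≢ x → w ⊆ˢ w′
            sub {w′ = w′} w∈ w≢x w′∈ w′≢x {c} c∈w = subst (_∈ w′) (mate-involutive c)
              (common-colours w′∈ x∈ mc∈x (disjoint-members x∈ w′∈ (w′≢x ∘ sym) mc∈x))
              where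
              mc∈x : mate c ∈ x
              mc∈x = common-colours x∈ w∈ c∈w (disjoint-members w∈ x∈ w≢x c∈w)

  -- Uncrossing and the extremal induction.

  module Bound (2≤n : 2 ≤ n) {t : ℕ} (1≤t : 1 ≤ t) where

    record CrossPair (p q : ℕ) : Set₁ where
      field
        𝓐 𝓑         : Family m
        𝓐?          : Decidable 𝓐
        𝓑?          : Decidable 𝓑
        𝓐⊆          : 𝓐 ⊆ 𝓗 X p
        𝓑⊆          : 𝓑 ⊆ 𝓗 X q
        𝓐-satisfiable : Satisfiable 𝓐
        𝓑-satisfiable : Satisfiable 𝓑
        cross       : CrossIntersecting t 𝓐 𝓑

      total : ℕ
      total = card 𝓐? + card 𝓑?

      transpose : CrossPair q p
      transpose = record
        { 𝓐? = 𝓑? ; 𝓑? = 𝓐? ; 𝓐⊆ = 𝓑⊆ ; 𝓑⊆ = 𝓐⊆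
        ; 𝓐-satisfiable = 𝓑-satisfiable ; 𝓑-satisfiable = 𝓐-satisfiable
        ; cross = λ {F} {G} F∈ G∈ → subst (λ S → t ≤ ∣ S ∣) (∩-comm G F) (cross G∈ F∈) }

    open CrossPair using (total; transpose)

    module _ (f : Symmetry) {𝓟 : Family m} (𝓟? : Decidable 𝓟) where

      image? : Decidable (𝓟 ∘ act f)
      image? = 𝓟? ∘ act f

      card-image : card image? ≡ card 𝓟?
      card-image = ≤-antisym
        (card-injection image? 𝓟? (act f) id λ _ _ → act-injective f)
        (card-injection 𝓟? image? (act f) (λ {F} F∈ → subst 𝓟 (sym (act-involutive f F)) F∈)
          λ _ _ → act-injective f)

      card-∪-∩-image : card 𝓟? + card 𝓟? ≡ card (𝓟? ∪? image?) + card (𝓟? ∩? image?)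
      card-∪-∩-image = trans (cong (card 𝓟? +_) (sym card-image)) (card-∪-∩ 𝓟? image?)

      image-⊆ : ∀ {p} → 𝓟 ⊆ 𝓗 X p → (𝓟 ∘ act f) ⊆ 𝓗 X p
      image-⊆ 𝓟⊆ {F} F∈ = subst (𝓗 X _) (act-involutive f F) (𝓗-act f (𝓟⊆ F∈))

    module _ {p q : ℕ} (P : CrossPair p q) (f : Symmetry) where

      open CrossPair P hiding (total; transpose)

      image-cross : CrossIntersecting t (𝓐 ∘ act f) (𝓑 ∘ act f)
      image-cross {F} {G} F∈ G∈ = ≤-trans (cross F∈ G∈) (size-act-∩ f F G)

      shrink : ∀ {z} → 𝓐 z → 𝓐 (act f z) → CrossPair p q
      shrink z∈ fz∈ = record
        { 𝓐? = 𝓐? ∩? image? f 𝓐? ; 𝓑? = 𝓑? ∪? image? f 𝓑?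
        ; 𝓐⊆ = 𝓐⊆ ∘ proj₁ ; 𝓑⊆ = [ 𝓑⊆ , image-⊆ f 𝓑? 𝓑⊆ ]′
        ; 𝓐-satisfiable = _ , z∈ , fz∈
        ; 𝓑-satisfiable = proj₁ 𝓑-satisfiable , inj₁ (proj₂ 𝓑-satisfiable)
        ; cross = λ { (F∈ , fF∈) → [ cross F∈ , image-cross fF∈ ]′ } }

      -- Non-emptiness of the intersection on the 𝓑 side is an assumption here; it comes from the
      -- count in `uncrossing`, whereas `shrink` takes its witness from `z`.
      grow : Satisfiable (λ G → 𝓑 G × 𝓑 (act f G)) → CrossPair p q
      grow sat = record
        { 𝓐? = 𝓐? ∪? image? f 𝓐? ; 𝓑? = 𝓑? ∩? image? f 𝓑?
        ; 𝓐⊆ = [ 𝓐⊆ , image-⊆ f 𝓐? 𝓐⊆ ]′ ; 𝓑⊆ = 𝓑⊆ ∘ proj₁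
        ; 𝓐-satisfiable = proj₁ 𝓐-satisfiable , inj₁ (proj₂ 𝓐-satisfiable)
        ; 𝓑-satisfiable = sat
        ; cross = λ { (inj₁ F∈) (G∈ , _) → cross F∈ G∈ ; (inj₂ fF∈) (_ , fG∈) → image-cross fF∈ fG∈ } }

    module _ (M : ℕ) where

      Bounded : ℕ → ℕ → Set
      Bounded p q = ∀ {x} → 𝓗 X p x → suc (card (Meeting? q t x)) ≤ M

      module _ {p q : ℕ} (bounded : Bounded p q) (P : CrossPair p q) where

        open CrossPair P hiding (total; transpose)

        -- If the total of `P` exceeds `M`, the two induction hypotheses make `P` a counterexample
        -- of maximal total and, among those, with minimal first family.
        step : card 𝓐? ≤ card 𝓑? →
          (∀ Q → total P < total Q → total Q ≤ M) →
          (∀ Q → total P ≡ total Q → card (CrossPair.𝓐? Q) < card 𝓐? → total Q ≤ M) →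
          total P ≤ M
        step 𝓐≤𝓑 larger smaller = decidable-stable (total P ≤? M) λ P≰M →
          let module P≰M = Exceeding P≰M in P≰M.absurd
          where
          module Exceeding (P≰M : ¬ total P ≤ M) where

            no-larger : ∀ Q → ¬ (total P < total Q)
            no-larger Q P<Q = P≰M (≤-trans (<⇒≤ P<Q) (larger Q P<Q))

            no-smaller : ∀ Q → card (CrossPair.𝓐? Q) < card 𝓐? → total Q < total P
            no-smaller Q lt = ≤∧≢⇒< (≮⇒≥ (no-larger Q)) λ Q≡P →
              P≰M (subst (_≤ M) Q≡P (smaller Q (sym Q≡P) lt))

            -- If `f` took `w` out of 𝓐, the shrunk pair would have a smaller first family, hence a
            -- smaller total, and by `uncrossing` the grown pair would exceed `P`.
            block : ∀ f {z w} → 𝓐 z → 𝓐 (act f z) → 𝓐 w → 𝓐 (act f w)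
            block f {z} {w} z∈ fz∈ w∈ = decidable-stable (𝓐? (act f w)) λ fw∉ →
              let 0<b∩ , P<Q = uncrossing (card-∪-∩-image f 𝓐?) (card-∪-∩-image f 𝓑?) 𝓐≤𝓑
                    (no-smaller (shrink P f z∈ fz∈)
                      (card-mono-< (𝓐? ∩? image? f 𝓐?) 𝓐? proj₁ w∈ (fw∉ ∘ proj₂)))
              in no-larger (grow P f (card-satisfiable (𝓑? ∩? image? f 𝓑?) 0<b∩)) P<Q

            open Block 1≤t 2≤n 𝓐? 𝓑? 𝓐⊆ 𝓑⊆ cross block (proj₂ 𝓑-satisfiable)

            too-big : ∀ {z} → 𝓐 z → ¬ (total P ≤ suc (card (Meeting? q t z)))
            too-big z∈ ≤D = P≰M (≤-trans ≤D (bounded (𝓐⊆ z∈)))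

            absurd : ⊥
            absurd = case m≤n⇒m<n∨m≡n 2≤n of λ
              { (inj₁ 3≤n) → impossible-n≥3 too-big 3≤n (proj₂ 𝓐-satisfiable)
              ; (inj₂ 2≡n) → Binary.impossible-n≡2 too-big (sym 2≡n) (proj₂ 𝓐-satisfiable) }

      least : ∀ {p q} → CrossPair p q → ℕ
      least P = card (CrossPair.𝓐? P) ⊓ card (CrossPair.𝓑? P)

      limit : ℕ
      limit = length (allSubsets m) + length (allSubsets m)

      total≤limit : ∀ {p q} (P : CrossPair p q) → total P ≤ limit
      total≤limit P = +-mono-≤ (length-filter (CrossPair.𝓐? P) (allSubsets m)) (length-filter (CrossPair.𝓑? P) (allSubsets m))

      private
        -- A lexicographic induction: `N₁` bounds how far the total can still rise and `N₂` bounds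
        -- the smaller family. A larger total spends `N₁` and resets `N₂`; an equal total with a
        -- smaller first family spends `N₂`.
        larger : ∀ N₁ {p q s} → Bounded p q → Bounded q p → limit ≤ N₁ + s →
          (Q : CrossPair p q) → s < total Q → total Q ≤ M
        smaller : ∀ N₁ N₂ {p q s a} → Bounded p q → Bounded q p → limit ≤ N₁ + s → a ≤ N₂ →
          (Q : CrossPair p q) → s ≡ total Q → card (CrossPair.𝓐? Q) < a → total Q ≤ M
        solve : ∀ N₁ N₂ {p q} → Bounded p q → Bounded q p → (P : CrossPair p q) →
          limit ≤ N₁ + total P → least P ≤ N₂ → total P ≤ M

        larger zero     b b′ lim Q s<Q = contradiction (total≤limit Q) (<⇒≱ (≤-trans (s≤s lim) s<Q))
        larger (suc N₁) {s = s} b b′ lim Q s<Q = solve N₁ (least Q) b b′ Q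
          (≤-trans lim (≤-trans (≤-reflexive (sym (+-suc N₁ s))) (+-monoʳ-≤ N₁ s<Q))) ≤-refl

        smaller N₁ zero     b b′ lim a≤0 Q s≡Q lt = contradiction (≤-trans lt a≤0) n≮0
        smaller N₁ (suc N₂) b b′ lim a≤N Q refl lt = solve N₁ N₂ b b′ Q lim
          (≤-trans (m⊓n≤m _ _) (≤-pred (≤-trans lt a≤N)))

        -- `step` wants the smaller family first. The pair may therefore have to be transposed,
        -- which is why bounds for both orders of the sizes are carried along.
        solve N₁ N₂ b b′ P lim least≤ with ≤-total (card (CrossPair.𝓐? P)) (card (CrossPair.𝓑? P))
        ... | inj₁ 𝓐≤𝓑 = step b P 𝓐≤𝓑 (larger N₁ b b′ lim)
          (smaller N₁ N₂ b b′ lim (subst (_≤ N₂) (m≤n⇒m⊓n≡m 𝓐≤𝓑) least≤))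
        ... | inj₂ 𝓑≤𝓐 = subst (_≤ M) (sym P≡Pᵀ) (step b′ (transpose P) 𝓑≤𝓐
          (larger N₁ b′ b limᵀ)
          (smaller N₁ N₂ b′ b limᵀ (subst (_≤ N₂) (m≥n⇒m⊓n≡n 𝓑≤𝓐) least≤)))
          where
          P≡Pᵀ : total P ≡ total (transpose P)
          P≡Pᵀ = +-comm (card (CrossPair.𝓐? P)) _
          limᵀ : limit ≤ N₁ + total (transpose P)
          limᵀ = subst (λ s → limit ≤ N₁ + s) P≡Pᵀ lim

      total-≤ : ∀ {p q} → Bounded p q → Bounded q p → (P : CrossPair p q) → total P ≤ M
      total-≤ b b′ P = solve limit (least P) b b′ P (m≤m+n limit (total P)) ≤-refl

-- The sets of smallest elements.

module _ {k m : ℕ} (v : Fin k → Fin m) where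

  ∈firstVs⁺ : ∀ {a i} → toℕ i < a → v i ∈ firstVs v a
  ∈firstVs⁺ {a} {i} i<a = x∈⋃⁺ (Any.map⁺ (lose
    (∈-filter⁺ (λ i → toℕ i <? a) (∈-allFin i) i<a) (x∈⁅x⁆ (v i))))

  ∈firstVs⁻ : ∀ {a e} → e ∈ firstVs v a → ∃ λ i → toℕ i < a × e ≡ v i
  ∈firstVs⁻ {a} {e} e∈ with find (Any.map⁻ (x∈⋃⁻ _ e∈))
  ... | i , i∈ , e∈⁅vi⁆ =
    i , proj₂ (∈-filter⁻ (λ i → toℕ i <? a) {xs = allFin k} i∈) , x∈⁅y⁆⇒x≡y (v i) e∈⁅vi⁆

  size-firstVs : (∀ {i j} → v i ≡ v j → i ≡ j) → ∀ {a} → a ≤ k → ∣ firstVs v a ∣ ≡ a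
  size-firstVs inj {zero} _ = trans
    (cong ∣_∣ (Empty-unique λ (e , e∈) → n≮0 (proj₁ (proj₂ (∈firstVs⁻ e∈))))) (∣⊥∣≡0 m)
  size-firstVs inj {suc a} a<k = trans (size-remove last∈) (cong suc
    (trans (cong ∣_∣ removed) (size-firstVs inj (<⇒≤ a<k))))
    where
    -- Indices start at 0, so the index with value `a` belongs to the last of the first a + 1
    -- elements.
    last : Fin k
    last = fromℕ< a<k
    last∈ : v last ∈ firstVs v (suc a)
    last∈ = ∈firstVs⁺ (s≤s (≤-reflexive (toℕ-fromℕ< a<k)))
    removed : firstVs v (suc a) - v last ≡ firstVs v a
    removed = ⊆-antisym to-⊆ from-⊆
      where
      to-⊆ : firstVs v (suc a) - v last ⊆ˢ firstVs v a
      to-⊆ e∈ with ∈firstVs⁻ (p─q⊆p _ ⁅ v last ⁆ e∈)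
      ... | i , i<1+a , refl = ∈firstVs⁺ (≤∧≢⇒< (≤-pred i<1+a) λ i≡a →
        x∉p-x (subst (λ j → v j ∈ firstVs v (suc a) - v last)
          (toℕ-injective (trans i≡a (sym (toℕ-fromℕ< a<k)))) e∈))
      from-⊆ : firstVs v a ⊆ˢ firstVs v (suc a) - v last
      from-⊆ e∈ with ∈firstVs⁻ e∈
      ... | i , i<a , refl = x∈p∧x≢y⇒x∈p-y (∈firstVs⁺ (m<n⇒m<1+n i<a)) λ vi≡ →
        <-irrefl (trans (cong toℕ (inj vi≡)) (toℕ-fromℕ< a<k)) i<a

∈-interval : ∀ {p q} → p ≤ q → q ∈ˡ interval p q
∈-interval {p} {q} p≤q = subst (_∈ˡ interval p q) (m+[n∸m]≡n p≤q)
  (∈-applyUpTo⁺ (p +_) (≤-reflexive (sym (+-∸-assoc 1 p≤q))))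

-- Comparison with the extremal pairs.

theorem1p6 : (n k ℓ ℓ′ t : ℕ) → 2 ≤ n → ℓ ≤ k → ℓ′ ≤ ℓ → t ≤ ℓ′ → 1 ≤ t →
    (X : Fin k → Subset (k * n)) → IsPartition n X →
    (v : Fin k → Fin (k * n)) → (∀ i → IsSmallest (X i) (v i)) →
    (𝓕 𝓖 : Family (k * n)) (𝓕? : Decidable 𝓕) (𝓖? : Decidable 𝓖) →
    𝓕 ⊆ 𝓗 X ℓ → 𝓖 ⊆ 𝓗 X ℓ′ →
    Satisfiable 𝓕 → Satisfiable 𝓖 →
    CrossIntersecting t 𝓕 𝓖 →
    card 𝓕? + card 𝓖? ≤
    max (card (𝓕₀? X v ℓ ℓ′ t) + card (𝓖₀? X v ℓ′))
    (map (λ a → card (𝓕ₐ? X v ℓ a) + card (𝓖ₐ? X v ℓ′ t a)) (interval (suc ℓ′) ℓ))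
theorem1p6 n k ℓ ℓ′ t 2≤n ℓ≤k ℓ′≤ℓ t≤ℓ′ 1≤t X part v smallest 𝓕 𝓖 𝓕? 𝓖? 𝓕⊆ 𝓖⊆ sat𝓕 sat𝓖 cross =
  total-≤ M bound bound′ record
    { 𝓐? = 𝓕? ; 𝓑? = 𝓖? ; 𝓐⊆ = 𝓕⊆ ; 𝓑⊆ = 𝓖⊆
    ; 𝓐-satisfiable = sat𝓕 ; 𝓑-satisfiable = sat𝓖 ; cross = cross }
  where
  open Partition part
  open Bound 2≤n 1≤t

  s₀ : ℕ
  s₀ = card (𝓕₀? X v ℓ ℓ′ t) + card (𝓖₀? X v ℓ′)
  sₐ : ℕ → ℕ
  sₐ a = card (𝓕ₐ? X v ℓ a) + card (𝓖ₐ? X v ℓ′ t a)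
  M : ℕ
  M = max s₀ (map sₐ (interval (suc ℓ′) ℓ))

  colour-v : ∀ i → colour (v i) ≡ i
  colour-v i = ∈X⇒colour (proj₁ (smallest i))

  firstVs-𝓗 : ∀ {a} → a ≤ k → 𝓗 X a (firstVs v a)
  firstVs-𝓗 {a} a≤k = size-firstVs v
      (λ {i} {j} eq → trans (sym (colour-v i)) (trans (cong colour eq) (colour-v j))) a≤k
    , proj₂ (transversal⇒𝓗 transversal)
    where
    transversal : Transversal (firstVs v a)
    transversal x∈ y∈ x~y with ∈firstVs⁻ v x∈ | ∈firstVs⁻ v y∈
    ... | i , _ , refl | j , _ , refl =
      cong v (trans (sym (colour-v i)) (trans x~y (colour-v j)))

  -- By transitivity `x` may be replaced by `firstVs v ℓ′`, whose partner is `𝓕₀`; the 1 is paid for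
  -- by `𝓖₀`.
  bound′ : Bounded M ℓ′ ℓ
  bound′ {x} Hx = begin
    suc (card (Meeting? ℓ t x))  ≤⟨ s≤s (card-meeting-transitive ℓ t Hx (firstVs-𝓗 (≤-trans ℓ′≤ℓ ℓ≤k))) ⟩
    suc (card (𝓕₀? X v ℓ ℓ′ t)) ≡⟨ +-comm 1 _ ⟩
    card (𝓕₀? X v ℓ ℓ′ t) + 1   ≤⟨ +-monoʳ-≤ _ (card>0 (𝓖₀? X v ℓ′) refl) ⟩
    s₀                           ≤⟨ ⊥≤max s₀ (map sₐ (interval (suc ℓ′) ℓ)) ⟩
    M                            ∎
    where open ≤-Reasoning

  -- For ℓ′ < ℓ the entry a = ℓ suffices: its `𝓕ₐ` contains `firstVs v ℓ`, which pays for the 1. For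
  -- ℓ′ = ℓ there is no such entry, and `bound′` already covers the case.
  bound : Bounded M ℓ ℓ′
  bound {x} Hx with m≤n⇒m<n∨m≡n ℓ′≤ℓ
  ... | inj₂ refl = bound′ Hx
  ... | inj₁ ℓ′<ℓ = begin
    suc (card (Meeting? ℓ′ t x))   ≤⟨ s≤s (card-meeting-transitive ℓ′ t Hx (firstVs-𝓗 ℓ≤k)) ⟩
    1 + card (𝓖ₐ? X v ℓ′ t ℓ)     ≤⟨ +-monoˡ-≤ _ (card>0 (𝓕ₐ? X v ℓ ℓ) (firstVs-𝓗 ℓ≤k , id)) ⟩
    sₐ ℓ                           ≤⟨ All.lookup (xs≤max s₀ (map sₐ (interval (suc ℓ′) ℓ)))
                                        (∈-map⁺ sₐ (∈-interval ℓ′<ℓ)) ⟩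
    M                              ∎
    where open ≤-Reasoning
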